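{- Let $G$ be a digraph and $\mathbb F$ a field, and for sheaves $\mathcal F$ of finite-dimensional $\mathbb F$-vector spaces on $G$ put $\alpha_1(\mathcal F)={\rm m.e.}(\mathcal F)$ and $\alpha_0(\mathcal F)=\chi(\mathcal F)+{\rm m.e.}(\mathcal F)$. Then $\alpha_0,\alpha_1$ take non-negative values; $\alpha_i(\mathcal F_1\oplus\mathcal F_2)=\alpha_i(\mathcal F_1)+\alpha_i(\mathcal F_2)$ for $i=0,1$; and for every short exact sequence $0\to\mathcal F_1\to\mathcal F_2\to\mathcal F_3\to0$ of sheaves on $G$ the sequence $$0,\ \alpha_1(\mathcal F_1),\ \alpha_1(\mathcal F_2),\ \alpha_1(\mathcal F_3),\ \alpha_0(\mathcal F_1),\ \alpha_0(\mathcal F_2),\ \alpha_0(\mathcal F_3),\ 0$$ is triangular, i.e. each term other than the first and last is at most the sum of its two neighbours. (That is, the maximum excess is a first quasi-Betti number.)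
   Context: Digraphs (finite, multiple edges and loops allowed) and sheaves $\mathcal F$ on them: finite-dimensional $\mathbb F$-vector spaces $\mathcal F(P)$, $P\in V_G\sqcup E_G$, with linear maps $\mathcal F(t,e)\colon\mathcal F(e)\to\mathcal F(t_Ge)$, $\mathcal F(h,e)\colon\mathcal F(e)\to\mathcal F(h_Ge)$. $\mathcal F(V)=\bigoplus_v\mathcal F(v)$, $\mathcal F(E)=\bigoplus_e\mathcal F(e)$, $\chi(\mathcal F)=\dim\mathcal F(V)-\dim\mathcal F(E)$; $d_h,d_t\colon\mathcal F(E)\to\mathcal F(V)$ send the summand $\mathcal F(e)$ into $\mathcal F(h_Ge)$, resp. $\mathcal F(t_Ge)$, via the restriction maps. For a subspace $U\subset\mathcal F(V)$, $\Gamma_{\rm ht}(U)=\bigoplus_{e}\{w\in\mathcal F(e):d_hw\in U,\ d_tw\in U\}$, ${\rm excess}(\mathcal F,U)=\dim\Gamma_{\rm ht}(U)-\dim U$, ${\rm m.e.}(\mathcal F)=\max_U{\rm excess}(\mathcal F,U)$. A morphism of sheaves $\alpha\colon\mathcal F\to\mathcal G$ is a family of linear maps $\alpha_P\colon\mathcal F(P)\to\mathcal G(P)$ with $\mathcal G(t,e)\alpha_e=\alpha_{te}\mathcal F(t,e)$ and $\mathcal G(h,e)\alpha_e=\alpha_{he}\mathcal F(h,e)$; direct sums are taken valuewise, and a sequence of sheaves is exact iff it is exact at every $P\in V_G\sqcup E_G$. -}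

module Defs where

open import Level using (Level; Lift; lift; lower) renaming (suc to lsuc)
open import Algebra.Apartness.Bundles using (HeytingField; HeytingCommutativeRing)
open import Algebra.Bundles using (CommutativeMonoid; CommutativeRing; Ring)
open import Algebra.Module.Bundles using (LeftModule)
import Algebra.Module.Construct.DirectProduct as DirectProduct
open import Algebra.Module.Morphism.Structures using (module LeftModuleMorphisms)
import Algebra.Module.Properties.LeftModule as LeftModuleProperties
import Algebra.Properties.CommutativeMonoid.Sum as Sum
import Algebra.Properties.CommutativeSemigroup as CommutativeSemigroupProperties
open import Axiom.ExcludedMiddle using (ExcludedMiddle)
open import Data.Empty using (⊥-elim)
open import Data.Fin.Base using (Fin; zero; suc; _↑ˡ_; _↑ʳ_; splitAt; join)
open import Data.Fin.Properties using (join-splitAt) renaming (_≟_ to _≟ᶠ_)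
open import Data.Integer.Base as ℤ using (ℤ; +_)
import Data.Integer.Properties as ℤ
open import Data.List.Base using (List; []; _∷_)
open import Data.Nat.Base as ℕ using (ℕ; zero; suc; z≤n; s≤s)
import Data.Nat.Properties as ℕ
open import Data.Product.Base using (Σ; ∃; ∃-syntax; _×_; _,_; proj₁; proj₂)
open import Data.Sum.Base using (_⊎_; inj₁; inj₂; [_,_])
open import Data.Unit.Polymorphic.Base using (⊤)
open import Data.Vec.Functional using (_++_) renaming (_∷_ to _∷ᵛ_)
import Data.Vec.Functional.Properties as Vec
open import Function.Base using (_∘_)
open import Function.Bundles using (_⇔_)
open import Function.Definitions using (Injective; Surjective)
open import Relation.Binary.PropositionalEquality as ≡ using (_≡_; refl)
import Relation.Binary.Reasoning.Setoid as SetoidReasoning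
open import Relation.Nullary using (¬_; Dec; yes; no)
import Relation.Nullary.Decidable as Dec

private
  variable
    m n : ℕ

record IsMaximum {a} {A : Set a} (f : A → ℤ) (k : ℤ) : Set a where
  field
    attained : ∃[ x ] f x ≡ k
    isUpper  : ∀ x → f x ℤ.≤ k

-- By induction on an upper bound d for the gap between f x and the bound.
maximum : ∀ {a} {A : Set a} → ExcludedMiddle a → (f : A → ℤ) (x : A)
          (d : ℕ) → (∀ y → f y ℤ.≤ f x ℤ.+ + d) → ∃ (IsMaximum f)
maximum em f x zero bound = f x , record
  { attained = x , refl
  ; isUpper  = λ y → ℤ.≤-trans (bound y) (ℤ.≤-reflexive (ℤ.+-identityʳ (f x)))
  }
maximum em f x (suc d) bound with em {∃[ y ] f x ℤ.< f y}
... | no ¬∃ = f x , record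
  { attained = x , refl
  ; isUpper  = λ y → ℤ.≮⇒≥ (λ fx<fy → ¬∃ (y , fx<fy))
  }
... | yes (x′ , fx<fx′) = maximum em f x′ d λ y → begin
  f y                          ≤⟨ bound y ⟩
  f x ℤ.+ (ℤ.1ℤ ℤ.+ + d)       ≡⟨ ℤ.+-assoc (f x) ℤ.1ℤ (+ d) ⟨
  (f x ℤ.+ ℤ.1ℤ) ℤ.+ + d       ≡⟨ ≡.cong (ℤ._+ + d) (ℤ.+-comm (f x) ℤ.1ℤ) ⟩
  ℤ.suc (f x) ℤ.+ + d          ≤⟨ ℤ.+-monoˡ-≤ (+ d) (ℤ.i<j⇒suc[i]≤j fx<fx′) ⟩
  f x′ ℤ.+ + d                 ∎
  where open ℤ.≤-Reasoning

Triangular : List ℤ → Set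
Triangular (x ∷ y ∷ z ∷ xs) = y ℤ.≤ x ℤ.+ z × Triangular (y ∷ z ∷ xs)
Triangular _                = ⊤

-- Under excluded middle the apartness relation of a HeytingField is just
-- ¬ (x ≈ y) (tightness), so these are exactly the fields of classical algebra.

module LinearAlgebra {ℓ : Level} (𝔽 : HeytingField ℓ ℓ ℓ) where

  private
    module 𝔽 = HeytingField 𝔽

  open 𝔽 using () renaming (Carrier to Scalar)

  ring : Ring ℓ ℓ
  ring = CommutativeRing.ring
    (HeytingCommutativeRing.commutativeRing 𝔽.heytingCommutativeRing)

  VectorSpace : Set (lsuc ℓ)
  VectorSpace = LeftModule ring ℓ ℓ

  ∣_∣ : VectorSpace → Set ℓ
  ∣ V ∣ = LeftModule.Carrierᴹ V

  module _ (V : VectorSpace) where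
    open LeftModule V
    open Sum +ᴹ-commutativeMonoid using (sum)

    lincomb : (Fin n → Scalar) → (Fin n → ∣ V ∣) → ∣ V ∣
    lincomb c b = sum λ i → c i *ₗ b i

    record IsBasis (b : Fin n → ∣ V ∣) : Set ℓ where
      field
        independent : ∀ c → lincomb c b ≈ᴹ 0ᴹ → ∀ i → c i 𝔽.≈ 𝔽.0#
        spanning    : ∀ x → ∃[ c ] lincomb c b ≈ᴹ x

    -- The basis is carried as data; dim is its length, which does not depend
    -- on the choice of basis.

    record FiniteDimensional : Set ℓ where
      constructor fd
      field
        dim     : ℕ
        basis   : Fin dim → ∣ V ∣
        isBasis : IsBasis basis

  open FiniteDimensional public using (dim)

  record LinearMap (V W : VectorSpace) : Set ℓ where
    private
      module V = LeftModule V
      module W = LeftModule W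
    open LeftModuleMorphisms V.rawLeftModule W.rawLeftModule
    field
      ⟦_⟧                      : ∣ V ∣ → ∣ W ∣
      isLeftModuleHomomorphism : IsLeftModuleHomomorphism ⟦_⟧
    open IsLeftModuleHomomorphism isLeftModuleHomomorphism public
      using (⟦⟧-cong; +ᴹ-homo; *ₗ-homo; 0ᴹ-homo)

  open LinearMap public using (⟦_⟧)

  record Subspace (V : VectorSpace) : Set (lsuc ℓ) where
    open LeftModule V
    infix 4 _∈
    field
      _∈        : ∣ V ∣ → Set ℓ
      ∈-resp-≈ᴹ : ∀ {x y} → x ≈ᴹ y → x ∈ → y ∈
      0ᴹ-∈      : 0ᴹ ∈
      +ᴹ-∈      : ∀ {x y} → x ∈ → y ∈ → x +ᴹ y ∈
      *ₗ-∈      : ∀ a {x} → x ∈ → a *ₗ x ∈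

  module _ {V W : VectorSpace} where
    private
      module V = LeftModule V
      module W = LeftModule W
    open SetoidReasoning W.≈ᴹ-setoid

    linearMap : (f : ∣ V ∣ → ∣ W ∣) →
                (∀ {x y} → x V.≈ᴹ y → f x W.≈ᴹ f y) →
                (∀ x y → f (x V.+ᴹ y) W.≈ᴹ f x W.+ᴹ f y) →
                (∀ a x → f (a V.*ₗ x) W.≈ᴹ a W.*ₗ f x) →
                LinearMap V W
    linearMap f f-cong f-+ f-* = record
      { ⟦_⟧ = f
      ; isLeftModuleHomomorphism = record
        { +ᴹ-isGroupHomomorphism = record
          { isMonoidHomomorphism = record
            { isMagmaHomomorphism = record
              { isRelHomomorphism = record { cong = f-cong }
              ; homo              = f-+
              }
            ; ε-homo = f-0
            }
          ; ⁻¹-homo = f-neg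
          }
        ; *ₗ-homo = f-*
        }
      }
      where
      f-0 : f V.0ᴹ W.≈ᴹ W.0ᴹ
      f-0 = begin
        f V.0ᴹ             ≈⟨ f-cong (V.*ₗ-zeroˡ V.0ᴹ) ⟨
        f (𝔽.0# V.*ₗ V.0ᴹ) ≈⟨ f-* 𝔽.0# V.0ᴹ ⟩
        𝔽.0# W.*ₗ f V.0ᴹ   ≈⟨ W.*ₗ-zeroˡ (f V.0ᴹ) ⟩
        W.0ᴹ               ∎

      f-neg : ∀ x → f (V.-ᴹ x) W.≈ᴹ W.-ᴹ f x
      f-neg x = LeftModuleProperties.inverseˡ-uniqueᴹ W (f (V.-ᴹ x)) (f x) (begin
        f (V.-ᴹ x) W.+ᴹ f x ≈⟨ f-+ (V.-ᴹ x) x ⟨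
        f (V.-ᴹ x V.+ᴹ x)   ≈⟨ f-cong (V.-ᴹ‿inverseˡ x) ⟩
        f V.0ᴹ              ≈⟨ f-0 ⟩
        W.0ᴹ                ∎)

  _∘ˡ_ : ∀ {U V W} → LinearMap V W → LinearMap U V → LinearMap U W
  _∘ˡ_ {W = W} g f = linearMap
    (λ x → ⟦ g ⟧ (⟦ f ⟧ x))
    (λ x≈y → g.⟦⟧-cong (f.⟦⟧-cong x≈y))
    (λ x y → W.≈ᴹ-trans (g.⟦⟧-cong (f.+ᴹ-homo x y)) (g.+ᴹ-homo _ _))
    (λ a x → W.≈ᴹ-trans (g.⟦⟧-cong (f.*ₗ-homo a x)) (g.*ₗ-homo a _))
    where
    module f = LinearMap f
    module g = LinearMap g
    module W = LeftModule W

  _×ᵛ_ : VectorSpace → VectorSpace → VectorSpace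
  _×ᵛ_ = DirectProduct.leftModule

  _×ˡ_ : ∀ {V V′ W W′} → LinearMap V W → LinearMap V′ W′ →
         LinearMap (V ×ᵛ V′) (W ×ᵛ W′)
  f ×ˡ g = linearMap
    (λ (x , y) → ⟦ f ⟧ x , ⟦ g ⟧ y)
    (λ (p , q) → f.⟦⟧-cong p , g.⟦⟧-cong q)
    (λ (x , y) (x′ , y′) → f.+ᴹ-homo x x′ , g.+ᴹ-homo y y′)
    (λ a (x , y) → f.*ₗ-homo a x , g.*ₗ-homo a y)
    where
    module f = LinearMap f
    module g = LinearMap g

  -- Finite direct sums, realised as products.

  ⨁ : (Fin n → VectorSpace) → VectorSpace
  ⨁ {n} V = record
    { Carrierᴹ = ∀ i → ∣ V i ∣
    ; _≈ᴹ_     = λ x y → ∀ i → V._≈ᴹ_ i (x i) (y i)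
    ; _+ᴹ_     = λ x y i → V._+ᴹ_ i (x i) (y i)
    ; _*ₗ_     = λ a x i → V._*ₗ_ i a (x i)
    ; 0ᴹ       = λ i → V.0ᴹ i
    ; -ᴹ_      = λ x i → V.-ᴹ_ i (x i)
    ; isLeftModule = record
      { isLeftSemimodule = record
        { +ᴹ-isCommutativeMonoid = record
          { isMonoid = record
            { isSemigroup = record
              { isMagma = record
                { isEquivalence = record
                  { refl  = λ i → V.≈ᴹ-refl i
                  ; sym   = λ p i → V.≈ᴹ-sym i (p i)
                  ; trans = λ p q i → V.≈ᴹ-trans i (p i) (q i)
                  }
                ; ∙-cong = λ p q i → V.+ᴹ-cong i (p i) (q i)
                }
              ; assoc = λ x y z i → V.+ᴹ-assoc i (x i) (y i) (z i)
              }
            ; identity = (λ x i → V.+ᴹ-identityˡ i (x i))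
                       , (λ x i → V.+ᴹ-identityʳ i (x i))
            }
          ; comm = λ x y i → V.+ᴹ-comm i (x i) (y i)
          }
        ; isPreleftSemimodule = record
          { *ₗ-cong      = λ p q i → V.*ₗ-cong i p (q i)
          ; *ₗ-zeroˡ     = λ x i → V.*ₗ-zeroˡ i (x i)
          ; *ₗ-distribʳ  = λ x a b i → V.*ₗ-distribʳ i (x i) a b
          ; *ₗ-identityˡ = λ x i → V.*ₗ-identityˡ i (x i)
          ; *ₗ-assoc     = λ a b x i → V.*ₗ-assoc i a b (x i)
          ; *ₗ-zeroʳ     = λ a i → V.*ₗ-zeroʳ i a
          ; *ₗ-distribˡ  = λ a x y i → V.*ₗ-distribˡ i a (x i) (y i)
          }
        }
      ; -ᴹ‿cong    = λ p i → V.-ᴹ‿cong i (p i)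
      ; -ᴹ‿inverse = (λ x i → V.-ᴹ‿inverseˡ i (x i))
                   , (λ x i → V.-ᴹ‿inverseʳ i (x i))
      }
    }
    where module V (i : Fin n) = LeftModule (V i)

  ι : (V : Fin n → VectorSpace) (i : Fin n) → LinearMap (V i) (⨁ V)
  ι {n} V i = linearMap (λ x j → single j (i ≟ᶠ j) x)
    (λ p j → single-cong j (i ≟ᶠ j) p)
    (λ x y j → single-+ j (i ≟ᶠ j) x y)
    (λ a x j → single-* j (i ≟ᶠ j) a x)
    where
    module V (i : Fin n) = LeftModule (V i)

    single : ∀ j → Dec (i ≡ j) → ∣ V i ∣ → ∣ V j ∣
    single j (yes refl) x = x
    single j (no _)     x = V.0ᴹ j

    single-cong : ∀ j i≟j {x y} → V._≈ᴹ_ i x y →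
                  V._≈ᴹ_ j (single j i≟j x) (single j i≟j y)
    single-cong j (yes refl) p = p
    single-cong j (no _)     p = V.≈ᴹ-refl j

    single-+ : ∀ j i≟j x y → V._≈ᴹ_ j (single j i≟j (V._+ᴹ_ i x y))
                                      (V._+ᴹ_ j (single j i≟j x) (single j i≟j y))
    single-+ j (yes refl) x y = V.≈ᴹ-refl j
    single-+ j (no _)     x y = V.≈ᴹ-sym j (V.+ᴹ-identityˡ j (V.0ᴹ j))

    single-* : ∀ j i≟j a x → V._≈ᴹ_ j (single j i≟j (V._*ₗ_ i a x))
                                      (V._*ₗ_ j a (single j i≟j x))
    single-* j (yes refl) a x = V.≈ᴹ-refl j
    single-* j (no _)     a x = V.≈ᴹ-sym j (V.*ₗ-zeroʳ j a)

  copair : {V : Fin n → VectorSpace} (W : VectorSpace) →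
           (∀ i → LinearMap (V i) W) → LinearMap (⨁ V) W
  copair {n} W f = linearMap (λ x → sum λ i → ⟦ f i ⟧ (x i))
    (λ p → sum-cong-≋ λ i → f.⟦⟧-cong i (p i))
    (λ x y → W.≈ᴹ-trans (sum-cong-≋ λ i → f.+ᴹ-homo i (x i) (y i))
                        (∑-distrib-+ (λ i → ⟦ f i ⟧ (x i)) (λ i → ⟦ f i ⟧ (y i))))
    (λ a x → W.≈ᴹ-trans (sum-cong-≋ λ i → f.*ₗ-homo i a (x i))
                        (sum-* a (λ i → ⟦ f i ⟧ (x i))))
    where
    module W = LeftModule W
    module f (i : Fin n) = LinearMap (f i)
    open Sum W.+ᴹ-commutativeMonoid

    sum-* : ∀ {n} a (x : Fin n → ∣ W ∣) →
            sum (λ i → a W.*ₗ x i) W.≈ᴹ a W.*ₗ sum x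
    sum-* {zero}  a x = W.≈ᴹ-sym (W.*ₗ-zeroʳ a)
    sum-* {suc n} a x = W.≈ᴹ-trans (W.+ᴹ-congˡ (sum-* a (x ∘ suc)))
                                   (W.≈ᴹ-sym (W.*ₗ-distribˡ a (x zero) (sum (x ∘ suc))))

  toSpace : {V : VectorSpace} → Subspace V → VectorSpace
  toSpace {V} U = record
    { Carrierᴹ = ∃ U._∈
    ; _≈ᴹ_     = λ x y → proj₁ x ≈ᴹ proj₁ y
    ; _+ᴹ_     = λ (x , p) (y , q) → x +ᴹ y , U.+ᴹ-∈ p q
    ; _*ₗ_     = λ a (x , p) → a *ₗ x , U.*ₗ-∈ a p
    ; 0ᴹ       = 0ᴹ , U.0ᴹ-∈
    ; -ᴹ_      = λ (x , p) → -ᴹ x , U.∈-resp-≈ᴹ (-1*x≈-x x) (U.*ₗ-∈ (𝔽.- 𝔽.1#) p)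
    ; isLeftModule = record
      { isLeftSemimodule = record
        { +ᴹ-isCommutativeMonoid = record
          { isMonoid = record
            { isSemigroup = record
              { isMagma = record
                { isEquivalence = record
                  { refl  = ≈ᴹ-refl
                  ; sym   = ≈ᴹ-sym
                  ; trans = ≈ᴹ-trans
                  }
                ; ∙-cong = +ᴹ-cong
                }
              ; assoc = λ _ _ _ → +ᴹ-assoc _ _ _
              }
            ; identity = (λ _ → +ᴹ-identityˡ _) , (λ _ → +ᴹ-identityʳ _)
            }
          ; comm = λ _ _ → +ᴹ-comm _ _
          }
        ; isPreleftSemimodule = record
          { *ₗ-cong      = *ₗ-cong
          ; *ₗ-zeroˡ     = λ _ → *ₗ-zeroˡ _
          ; *ₗ-distribʳ  = λ _ → *ₗ-distribʳ _
          ; *ₗ-identityˡ = λ _ → *ₗ-identityˡ _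
          ; *ₗ-assoc     = λ a b _ → *ₗ-assoc a b _
          ; *ₗ-zeroʳ     = *ₗ-zeroʳ
          ; *ₗ-distribˡ  = λ a _ _ → *ₗ-distribˡ a _ _
          }
        }
      ; -ᴹ‿cong    = -ᴹ‿cong
      ; -ᴹ‿inverse = (λ _ → -ᴹ‿inverseˡ _) , (λ _ → -ᴹ‿inverseʳ _)
      }
    }
    where
    module U = Subspace U
    open LeftModule V
    open SetoidReasoning ≈ᴹ-setoid

    -1*x≈-x : ∀ x → (𝔽.- 𝔽.1#) *ₗ x ≈ᴹ -ᴹ x
    -1*x≈-x x = LeftModuleProperties.inverseˡ-uniqueᴹ V _ x (begin
      (𝔽.- 𝔽.1#) *ₗ x +ᴹ x            ≈⟨ +ᴹ-congˡ (*ₗ-identityˡ x) ⟨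
      (𝔽.- 𝔽.1#) *ₗ x +ᴹ 𝔽.1# *ₗ x    ≈⟨ *ₗ-distribʳ x (𝔽.- 𝔽.1#) 𝔽.1# ⟨
      ((𝔽.- 𝔽.1#) 𝔽.+ 𝔽.1#) *ₗ x      ≈⟨ *ₗ-congʳ (𝔽.-‿inverseˡ 𝔽.1#) ⟩
      𝔽.0# *ₗ x                       ≈⟨ *ₗ-zeroˡ x ⟩
      0ᴹ                              ∎)

  zeroSubspace : (V : VectorSpace) → Subspace V
  zeroSubspace V = record
    { _∈        = _≈ᴹ 0ᴹ
    ; ∈-resp-≈ᴹ = λ x≈y x≈0 → ≈ᴹ-trans (≈ᴹ-sym x≈y) x≈0
    ; 0ᴹ-∈      = ≈ᴹ-refl
    ; +ᴹ-∈      = λ x≈0 y≈0 → ≈ᴹ-trans (+ᴹ-cong x≈0 y≈0) (+ᴹ-identityˡ 0ᴹ)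
    ; *ₗ-∈      = λ a x≈0 → ≈ᴹ-trans (*ₗ-congˡ x≈0) (*ₗ-zeroʳ a)
    }
    where open LeftModule V

  preimage : ∀ {V W} → LinearMap V W → Subspace W → Subspace V
  preimage {W = W} f U = record
    { _∈        = λ x → ⟦ f ⟧ x U.∈
    ; ∈-resp-≈ᴹ = λ x≈y → U.∈-resp-≈ᴹ (f.⟦⟧-cong x≈y)
    ; 0ᴹ-∈      = U.∈-resp-≈ᴹ (W.≈ᴹ-sym f.0ᴹ-homo) U.0ᴹ-∈
    ; +ᴹ-∈      = λ p q → U.∈-resp-≈ᴹ (W.≈ᴹ-sym (f.+ᴹ-homo _ _)) (U.+ᴹ-∈ p q)
    ; *ₗ-∈      = λ a p → U.∈-resp-≈ᴹ (W.≈ᴹ-sym (f.*ₗ-homo a _)) (U.*ₗ-∈ a p)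
    }
    where
    module U = Subspace U
    module f = LinearMap f
    module W = LeftModule W

  _∩_ : ∀ {V} → Subspace V → Subspace V → Subspace V
  U ∩ U′ = record
    { _∈        = λ x → x U.∈ × x U′.∈
    ; ∈-resp-≈ᴹ = λ x≈y (p , p′) → U.∈-resp-≈ᴹ x≈y p , U′.∈-resp-≈ᴹ x≈y p′
    ; 0ᴹ-∈      = U.0ᴹ-∈ , U′.0ᴹ-∈
    ; +ᴹ-∈      = λ (p , p′) (q , q′) → U.+ᴹ-∈ p q , U′.+ᴹ-∈ p′ q′
    ; *ₗ-∈      = λ a (p , p′) → U.*ₗ-∈ a p , U′.*ₗ-∈ a p′
    }
    where
    module U  = Subspace U
    module U′ = Subspace U′

  module _ (V : VectorSpace) where
    open LeftModule V
    open SetoidReasoning ≈ᴹ-setoid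

    lincomb-cong : {c c′ : Fin n → Scalar} {b b′ : Fin n → ∣ V ∣} →
                   (∀ i → c i 𝔽.≈ c′ i) → (∀ i → b i ≈ᴹ b′ i) →
                   lincomb V c b ≈ᴹ lincomb V c′ b′
    lincomb-cong p q = Sum.sum-cong-≋ +ᴹ-commutativeMonoid λ i → *ₗ-cong (p i) (q i)

    lincomb-zeroˡ : (b : Fin n → ∣ V ∣) → lincomb V (λ _ → 𝔽.0#) b ≈ᴹ 0ᴹ
    lincomb-zeroˡ {zero}  b = ≈ᴹ-refl
    lincomb-zeroˡ {suc n} b = ≈ᴹ-trans
      (+ᴹ-cong (*ₗ-zeroˡ (b zero)) (lincomb-zeroˡ (b ∘ suc))) (+ᴹ-identityˡ 0ᴹ)

    lincomb-zeroʳ : (c : Fin n → Scalar) → lincomb V c (λ _ → 0ᴹ) ≈ᴹ 0ᴹ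
    lincomb-zeroʳ {zero}  c = ≈ᴹ-refl
    lincomb-zeroʳ {suc n} c = ≈ᴹ-trans
      (+ᴹ-cong (*ₗ-zeroʳ (c zero)) (lincomb-zeroʳ (c ∘ suc))) (+ᴹ-identityˡ 0ᴹ)

    lincomb-+ : (c c′ : Fin n → Scalar) (b : Fin n → ∣ V ∣) →
                lincomb V (λ i → c i 𝔽.+ c′ i) b ≈ᴹ lincomb V c b +ᴹ lincomb V c′ b
    lincomb-+ c c′ b = ≈ᴹ-trans
      (sum-cong-≋ λ i → *ₗ-distribʳ (b i) (c i) (c′ i))
      (∑-distrib-+ (λ i → c i *ₗ b i) (λ i → c′ i *ₗ b i))
      where open Sum +ᴹ-commutativeMonoid

    lincomb-* : (a : Scalar) (c : Fin n → Scalar) (b : Fin n → ∣ V ∣) →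
                lincomb V (λ i → a 𝔽.* c i) b ≈ᴹ a *ₗ lincomb V c b
    lincomb-* {zero}  a c b = ≈ᴹ-sym (*ₗ-zeroʳ a)
    lincomb-* {suc n} a c b = ≈ᴹ-trans
      (+ᴹ-cong (*ₗ-assoc a (c zero) (b zero)) (lincomb-* a (c ∘ suc) (b ∘ suc)))
      (≈ᴹ-sym (*ₗ-distribˡ a _ _))

    lincomb-split : (c : Fin (m ℕ.+ n) → Scalar) (b : Fin (m ℕ.+ n) → ∣ V ∣) →
      lincomb V c b ≈ᴹ
      lincomb V (λ i → c (i ↑ˡ n)) (λ i → b (i ↑ˡ n)) +ᴹ
      lincomb V (λ j → c (m ↑ʳ j)) (λ j → b (m ↑ʳ j))
    lincomb-split {zero}  c b = ≈ᴹ-sym (+ᴹ-identityˡ _)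
    lincomb-split {suc m} c b = ≈ᴹ-trans
      (+ᴹ-congˡ (lincomb-split {m} (c ∘ suc) (b ∘ suc))) (≈ᴹ-sym (+ᴹ-assoc _ _ _))

    lincomb-++ : (c : Fin m → Scalar) (c′ : Fin n → Scalar)
                 (b : Fin m → ∣ V ∣) (b′ : Fin n → ∣ V ∣) →
                 lincomb V (c ++ c′) (b ++ b′) ≈ᴹ lincomb V c b +ᴹ lincomb V c′ b′
    lincomb-++ {m} c c′ b b′ = ≈ᴹ-trans (lincomb-split {m} (c ++ c′) (b ++ b′))
      (+ᴹ-cong
        (lincomb-cong (λ i → 𝔽.reflexive (Vec.lookup-++ˡ c c′ i))
                      (λ i → ≈ᴹ-reflexive (Vec.lookup-++ˡ b b′ i)))
        (lincomb-cong (λ i → 𝔽.reflexive (Vec.lookup-++ʳ c c′ i))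
                      (λ i → ≈ᴹ-reflexive (Vec.lookup-++ʳ b b′ i))))

  module _ {V W : VectorSpace} (f : LinearMap V W) where
    private
      module f = LinearMap f
      module W = LeftModule W

    map-lincomb : (c : Fin n → Scalar) (b : Fin n → ∣ V ∣) →
                  ⟦ f ⟧ (lincomb V c b) W.≈ᴹ lincomb W c (⟦ f ⟧ ∘ b)
    map-lincomb {zero}  c b = f.0ᴹ-homo
    map-lincomb {suc n} c b = W.≈ᴹ-trans (f.+ᴹ-homo _ _)
      (W.+ᴹ-cong (f.*ₗ-homo (c zero) (b zero)) (map-lincomb (c ∘ suc) (b ∘ suc)))

  record Biproduct (V Q W : VectorSpace) : Set ℓ where
    private
      module V = LeftModule V
      module W = LeftModule W
      module Q = LeftModule Q
    field
      i : LinearMap V W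
      r : LinearMap W V
      s : LinearMap Q W
      p : LinearMap W Q
      ri≈id    : ∀ x → ⟦ r ⟧ (⟦ i ⟧ x) V.≈ᴹ x
      rs≈0     : ∀ x → ⟦ r ⟧ (⟦ s ⟧ x) V.≈ᴹ V.0ᴹ
      pi≈0     : ∀ x → ⟦ p ⟧ (⟦ i ⟧ x) Q.≈ᴹ Q.0ᴹ
      ps≈id    : ∀ x → ⟦ p ⟧ (⟦ s ⟧ x) Q.≈ᴹ x
      ir+sp≈id : ∀ x → ⟦ i ⟧ (⟦ r ⟧ x) W.+ᴹ ⟦ s ⟧ (⟦ p ⟧ x) W.≈ᴹ x

  module _ {V Q W : VectorSpace} (biproduct : Biproduct V Q W) where
    open Biproduct biproduct
    private
      module V = LeftModule V
      module W = LeftModule W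
      module Q = LeftModule Q
      module i = LinearMap i
      module r = LinearMap r
      module s = LinearMap s
      module p = LinearMap p

    biproduct-fd : FiniteDimensional V → FiniteDimensional Q → FiniteDimensional W
    biproduct-fd (fd m b b-basis) (fd n e e-basis) = fd (m ℕ.+ n) ie record
      { independent = λ c c≈0 k → ≡.subst (λ k → c k 𝔽.≈ 𝔽.0#)
          (join-splitAt m n k) (indep c c≈0 (splitAt m k))
      ; spanning = λ x →
          let c , c≈  = B.spanning (⟦ r ⟧ x)
              d , d≈  = E.spanning (⟦ p ⟧ x)
          in c ++ d , W.≈ᴹ-trans (lincomb-++ W c d (⟦ i ⟧ ∘ b) (⟦ s ⟧ ∘ e)) (W.≈ᴹ-trans
               (W.+ᴹ-cong
                 (W.≈ᴹ-trans (W.≈ᴹ-sym (map-lincomb i c b)) (i.⟦⟧-cong c≈))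
                 (W.≈ᴹ-trans (W.≈ᴹ-sym (map-lincomb s d e)) (s.⟦⟧-cong d≈)))
               (ir+sp≈id x))
      }
      where
      module B = IsBasis b-basis
      module E = IsBasis e-basis

      ie : Fin (m ℕ.+ n) → ∣ W ∣
      ie = (⟦ i ⟧ ∘ b) ++ (⟦ s ⟧ ∘ e)

      module _ (c : Fin (m ℕ.+ n) → Scalar) where
        c₁ = λ k → c (k ↑ˡ n)
        c₂ = λ k → c (m ↑ʳ k)

        split : lincomb W c ie W.≈ᴹ
                ⟦ i ⟧ (lincomb V c₁ b) W.+ᴹ ⟦ s ⟧ (lincomb Q c₂ e)
        split = W.≈ᴹ-trans (lincomb-split W {m} c ie) (W.+ᴹ-cong
          (W.≈ᴹ-trans
            (lincomb-cong W {c = c₁} (λ _ → 𝔽.refl) λ k →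
              W.≈ᴹ-reflexive (Vec.lookup-++ˡ (⟦ i ⟧ ∘ b) (⟦ s ⟧ ∘ e) k))
            (W.≈ᴹ-sym (map-lincomb i c₁ b)))
          (W.≈ᴹ-trans
            (lincomb-cong W {c = c₂} (λ _ → 𝔽.refl) λ k →
              W.≈ᴹ-reflexive (Vec.lookup-++ʳ (⟦ i ⟧ ∘ b) (⟦ s ⟧ ∘ e) k))
            (W.≈ᴹ-sym (map-lincomb s c₂ e))))

        module _ (c≈0 : lincomb W c ie W.≈ᴹ W.0ᴹ) where
          sum≈0 = W.≈ᴹ-trans (W.≈ᴹ-sym split) c≈0

          c₁≈0 : lincomb V c₁ b V.≈ᴹ V.0ᴹ
          c₁≈0 = begin
            x                                              ≈⟨ V.+ᴹ-identityʳ x ⟨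
            x V.+ᴹ V.0ᴹ                                    ≈⟨ V.+ᴹ-cong (ri≈id x) (rs≈0 y) ⟨
            ⟦ r ⟧ (⟦ i ⟧ x) V.+ᴹ ⟦ r ⟧ (⟦ s ⟧ y)           ≈⟨ r.+ᴹ-homo _ _ ⟨
            ⟦ r ⟧ (⟦ i ⟧ x W.+ᴹ ⟦ s ⟧ y)                   ≈⟨ r.⟦⟧-cong sum≈0 ⟩
            ⟦ r ⟧ W.0ᴹ                                     ≈⟨ r.0ᴹ-homo ⟩
            V.0ᴹ                                           ∎
            where
            open SetoidReasoning V.≈ᴹ-setoid
            x = lincomb V c₁ b
            y = lincomb Q c₂ e

          c₂≈0 : lincomb Q c₂ e Q.≈ᴹ Q.0ᴹ
          c₂≈0 = begin
            y                                              ≈⟨ Q.+ᴹ-identityˡ y ⟨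
            Q.0ᴹ Q.+ᴹ y                                    ≈⟨ Q.+ᴹ-cong (pi≈0 x) (ps≈id y) ⟨
            ⟦ p ⟧ (⟦ i ⟧ x) Q.+ᴹ ⟦ p ⟧ (⟦ s ⟧ y)           ≈⟨ p.+ᴹ-homo _ _ ⟨
            ⟦ p ⟧ (⟦ i ⟧ x W.+ᴹ ⟦ s ⟧ y)                   ≈⟨ p.⟦⟧-cong sum≈0 ⟩
            ⟦ p ⟧ W.0ᴹ                                     ≈⟨ p.0ᴹ-homo ⟩
            Q.0ᴹ                                           ∎
            where
            open SetoidReasoning Q.≈ᴹ-setoid
            x = lincomb V c₁ b
            y = lincomb Q c₂ e

          indep : ∀ k → c (join m n k) 𝔽.≈ 𝔽.0#
          indep (inj₁ k) = B.independent c₁ c₁≈0 k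
          indep (inj₂ k) = E.independent c₂ c₂≈0 k

  ×ᵛ-fd : ∀ {V W} → FiniteDimensional V → FiniteDimensional W →
          FiniteDimensional (V ×ᵛ W)
  ×ᵛ-fd {V} {W} = biproduct-fd record
    { i = linearMap (λ x → x , W.0ᴹ) (λ p → p , W.≈ᴹ-refl)
            (λ _ _ → V.≈ᴹ-refl , W.≈ᴹ-sym (W.+ᴹ-identityˡ W.0ᴹ))
            (λ a _ → V.≈ᴹ-refl , W.≈ᴹ-sym (W.*ₗ-zeroʳ a))
    ; r = linearMap proj₁ proj₁ (λ _ _ → V.≈ᴹ-refl) (λ _ _ → V.≈ᴹ-refl)
    ; s = linearMap (λ x → V.0ᴹ , x) (λ p → V.≈ᴹ-refl , p)
            (λ _ _ → V.≈ᴹ-sym (V.+ᴹ-identityˡ V.0ᴹ) , W.≈ᴹ-refl)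
            (λ a _ → V.≈ᴹ-sym (V.*ₗ-zeroʳ a) , W.≈ᴹ-refl)
    ; p = linearMap proj₂ proj₂ (λ _ _ → W.≈ᴹ-refl) (λ _ _ → W.≈ᴹ-refl)
    ; ri≈id    = λ _ → V.≈ᴹ-refl
    ; rs≈0     = λ _ → V.≈ᴹ-refl
    ; pi≈0     = λ _ → W.≈ᴹ-refl
    ; ps≈id    = λ _ → W.≈ᴹ-refl
    ; ir+sp≈id = λ _ → V.+ᴹ-identityʳ _ , W.+ᴹ-identityˡ _
    }
    where
    module V = LeftModule V
    module W = LeftModule W

  ⨁-fd : {V : Fin n → VectorSpace} → (∀ i → FiniteDimensional (V i)) →
         FiniteDimensional (⨁ V)
  ⨁-fd {zero}      _     = fd 0 (λ ()) record
    { independent = λ _ _ ()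
    ; spanning    = λ _ → (λ ()) , λ ()
    }
  ⨁-fd {suc n} {V} V-fd = biproduct-fd
    record
    { i = linearMap (λ x → cons x (λ i → V.0ᴹ (suc i)))
            (λ p → λ where
              zero    → p
              (suc i) → V.≈ᴹ-refl (suc i))
            (λ _ _ → λ where
              zero    → V.≈ᴹ-refl zero
              (suc i) → V.≈ᴹ-sym (suc i) (V.+ᴹ-identityˡ (suc i) _))
            (λ a _ → λ where
              zero    → V.≈ᴹ-refl zero
              (suc i) → V.≈ᴹ-sym (suc i) (V.*ₗ-zeroʳ (suc i) a))
    ; r = linearMap (λ x → x zero) (λ p → p zero)
            (λ _ _ → V.≈ᴹ-refl zero) (λ _ _ → V.≈ᴹ-refl zero)
    ; s = linearMap (λ x → cons (V.0ᴹ zero) x)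
            (λ p → λ where
              zero    → V.≈ᴹ-refl zero
              (suc i) → p i)
            (λ _ _ → λ where
              zero    → V.≈ᴹ-sym zero (V.+ᴹ-identityˡ zero _)
              (suc i) → V.≈ᴹ-refl (suc i))
            (λ a _ → λ where
              zero    → V.≈ᴹ-sym zero (V.*ₗ-zeroʳ zero a)
              (suc i) → V.≈ᴹ-refl (suc i))
    ; p = linearMap (λ x i → x (suc i)) (λ p i → p (suc i))
            (λ _ _ i → V.≈ᴹ-refl (suc i)) (λ _ _ i → V.≈ᴹ-refl (suc i))
    ; ri≈id    = λ _ → V.≈ᴹ-refl zero
    ; rs≈0     = λ _ → V.≈ᴹ-refl zero
    ; pi≈0     = λ _ i → V.≈ᴹ-refl (suc i)
    ; ps≈id    = λ _ i → V.≈ᴹ-refl (suc i)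
    ; ir+sp≈id = λ _ → λ where
        zero    → V.+ᴹ-identityʳ zero _
        (suc i) → V.+ᴹ-identityˡ (suc i) _
    }
    (V-fd zero) (⨁-fd (V-fd ∘ suc))
    where
    module V (i : Fin (suc n)) = LeftModule (V i)

    cons : ∣ V zero ∣ → (∀ i → ∣ V (suc i) ∣) → ∀ i → ∣ V i ∣
    cons x xs zero    = x
    cons x xs (suc i) = xs i

  dim-⨁-mono : {V W : Fin n → VectorSpace}
               (V-fd : ∀ i → FiniteDimensional (V i))
               (W-fd : ∀ i → FiniteDimensional (W i)) →
               (∀ i → dim (V-fd i) ℕ.≤ dim (W-fd i)) →
               dim (⨁-fd V-fd) ℕ.≤ dim (⨁-fd W-fd)
  dim-⨁-mono {zero}  _    _    _  = z≤n
  dim-⨁-mono {suc n} V-fd W-fd le =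
    ℕ.+-mono-≤ (le zero) (dim-⨁-mono (V-fd ∘ suc) (W-fd ∘ suc) (le ∘ suc))

  module _ (em : ExcludedMiddle ℓ) where

    ≉0⇒invertible : ∀ {a} → ¬ a 𝔽.≈ 𝔽.0# → ∃[ b ] b 𝔽.* a 𝔽.≈ 𝔽.1#
    ≉0⇒invertible {a} a≉0 with em {a 𝔽.# 𝔽.0#}
    ... | no ¬a#0 = ⊥-elim (a≉0 (proj₁ (𝔽.tight a 𝔽.0#) ¬a#0))
    ... | yes a#0 with b , ba≈1 , _ ← 𝔽.#⇒invertible a#0 =
      b , 𝔽.trans (𝔽.*-congˡ (𝔽.sym a-0≈a)) ba≈1
      where
      a-0≈a : a 𝔽.+ 𝔽.- 𝔽.0# 𝔽.≈ a
      a-0≈a = 𝔽.trans (𝔽.+-congˡ (𝔽.trans (𝔽.sym (𝔽.+-identityˡ _)) (𝔽.-‿inverseʳ 𝔽.0#)))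
                      (𝔽.+-identityʳ a)

    module _ {V : VectorSpace} where
      open LeftModule V
      open SetoidReasoning ≈ᴹ-setoid

      span : (Fin n → ∣ V ∣) → Subspace V
      span v = record
        { _∈        = λ x → ∃[ c ] lincomb V c v ≈ᴹ x
        ; ∈-resp-≈ᴹ = λ x≈y (c , p) → c , ≈ᴹ-trans p x≈y
        ; 0ᴹ-∈      = _ , lincomb-zeroˡ V v
        ; +ᴹ-∈      = λ (c , p) (d , q) → _ , ≈ᴹ-trans (lincomb-+ V c d v) (+ᴹ-cong p q)
        ; *ₗ-∈      = λ a (c , p) → _ , ≈ᴹ-trans (lincomb-* V a c v) (*ₗ-congˡ p)
        }

      -ᴹ-∈ : (U : Subspace V) (let open Subspace U) → ∀ {x} → x ∈ → -ᴹ x ∈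
      -ᴹ-∈ U {x} x∈ = proj₂ (LeftModule.-ᴹ_ (toSpace U) (x , x∈))

      lincomb-∈ : (U : Subspace V) (let open Subspace U) (c : Fin n → Scalar)
                  {b : Fin n → ∣ V ∣} → (∀ i → b i ∈) → lincomb V c b ∈
      lincomb-∈ {zero}  U c b∈ = Subspace.0ᴹ-∈ U
      lincomb-∈ {suc n} U c b∈ = +ᴹ-∈ (*ₗ-∈ (c zero) (b∈ zero)) (lincomb-∈ U (c ∘ suc) (b∈ ∘ suc))
        where open Subspace U

      record SubBasis (U : Subspace V) (n : ℕ) : Set ℓ where
        open Subspace U
        field
          size        : ℕ
          size≤       : size ℕ.≤ n
          vec         : Fin size → ∣ V ∣
          vec-∈       : ∀ i → vec i ∈
          independent : ∀ c → lincomb V c vec ≈ᴹ 0ᴹ → ∀ i → c i 𝔽.≈ 𝔽.0#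
          spanning    : ∀ {x} → x ∈ → ∃[ c ] lincomb V c vec ≈ᴹ x

      subBasis : (v : Fin n → ∣ V ∣) (U : Subspace V) (let open Subspace U) →
                 (∀ {x} → x ∈ → ∃[ c ] lincomb V c v ≈ᴹ x) → SubBasis U n
      subBasis {zero} v U U⊆v = record
        { size        = 0
        ; size≤       = z≤n
        ; vec         = λ ()
        ; vec-∈       = λ ()
        ; independent = λ _ _ ()
        ; spanning    = λ x∈ → (λ ()) , proj₂ (U⊆v x∈)
        }
      subBasis {suc n} v U U⊆v = extend (em {∃[ w ] w U.∈ × ¬ w U′.∈})
        where
        module U = Subspace U

        U′ : Subspace V
        U′ = U ∩ span (v ∘ suc)

        module U′ = Subspace U′
        module B = SubBasis (subBasis (v ∘ suc) U′ proj₂)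

        extend : Dec (∃[ w ] w U.∈ × ¬ w U′.∈) → SubBasis U (suc n)
        extend (no ¬∃) = record
          { size        = B.size
          ; size≤       = ℕ.m≤n⇒m≤1+n B.size≤
          ; vec         = B.vec
          ; vec-∈       = proj₁ ∘ B.vec-∈
          ; independent = B.independent
          ; spanning    = λ {x} x∈ → B.spanning
              (Dec.decidable-stable em λ x∉ → ¬∃ (x , x∈ , x∉))
          }
        extend (yes (w , w∈ , w∉)) = record
          { size        = suc B.size
          ; size≤       = s≤s B.size≤
          ; vec         = w ∷ᵛ B.vec
          ; vec-∈       = λ where zero → w∈; (suc i) → proj₁ (B.vec-∈ i)
          ; independent = indep
          ; spanning    = spans
          }
          where
          c   = proj₁ (U⊆v w∈)
          c₀  = c zero
          v₀  = v zero
          s   = lincomb V (c ∘ suc) (v ∘ suc)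

          c≈w : c₀ *ₗ v₀ +ᴹ s ≈ᴹ w
          c≈w = proj₂ (U⊆v w∈)

          c₀≉0 : ¬ c₀ 𝔽.≈ 𝔽.0#
          c₀≉0 c₀≈0 = w∉ (w∈ , c ∘ suc , (begin
            s                  ≈⟨ +ᴹ-identityˡ s ⟨
            0ᴹ +ᴹ s            ≈⟨ +ᴹ-congʳ (*ₗ-zeroˡ v₀) ⟨
            𝔽.0# *ₗ v₀ +ᴹ s    ≈⟨ +ᴹ-congʳ (*ₗ-congʳ c₀≈0) ⟨
            c₀ *ₗ v₀ +ᴹ s      ≈⟨ c≈w ⟩
            w                  ∎))

          indep : ∀ d → lincomb V d (w ∷ᵛ B.vec) ≈ᴹ 0ᴹ → ∀ i → d i 𝔽.≈ 𝔽.0#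
          indep d d≈0 = λ where
              zero    → d₀≈0
              (suc i) → B.independent (d ∘ suc) rest≈0 i
            where
            d₀ = d zero
            t  = lincomb V (d ∘ suc) B.vec

            d₀≉0⇒w∈ : ¬ d₀ 𝔽.≈ 𝔽.0# → w U′.∈
            d₀≉0⇒w∈ d₀≉0 with e , ed₀≈1 ← ≉0⇒invertible d₀≉0 =
              U′.∈-resp-≈ᴹ eq (U′.*ₗ-∈ e (-ᴹ-∈ U′ (lincomb-∈ U′ (d ∘ suc) B.vec-∈)))
              where
              eq : e *ₗ (-ᴹ t) ≈ᴹ w
              eq = begin
                e *ₗ (-ᴹ t)           ≈⟨ *ₗ-congˡ (LeftModuleProperties.inverseˡ-uniqueᴹ V _ t d≈0) ⟨
                e *ₗ d₀ *ₗ w          ≈⟨ *ₗ-assoc e d₀ w ⟨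
                (e 𝔽.* d₀) *ₗ w       ≈⟨ *ₗ-congʳ ed₀≈1 ⟩
                𝔽.1# *ₗ w             ≈⟨ *ₗ-identityˡ w ⟩
                w                     ∎

            d₀≈0 : d₀ 𝔽.≈ 𝔽.0#
            d₀≈0 = Dec.decidable-stable em (λ d₀≉0 → w∉ (d₀≉0⇒w∈ d₀≉0))

            rest≈0 : t ≈ᴹ 0ᴹ
            rest≈0 = begin
              t                  ≈⟨ +ᴹ-identityˡ t ⟨
              0ᴹ +ᴹ t            ≈⟨ +ᴹ-congʳ (*ₗ-zeroˡ w) ⟨
              𝔽.0# *ₗ w +ᴹ t     ≈⟨ +ᴹ-congʳ (*ₗ-congʳ d₀≈0) ⟨
              d₀ *ₗ w +ᴹ t       ≈⟨ d≈0 ⟩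
              0ᴹ                 ∎

          spans : ∀ {x} → x U.∈ → ∃[ d ] lincomb V d (w ∷ᵛ B.vec) ≈ᴹ x
          spans {x} x∈ = (𝔽.- r) ∷ᵛ d , (begin
            (𝔽.- r) *ₗ w +ᴹ lincomb V d B.vec         ≈⟨ +ᴹ-congˡ d≈y ⟩
            (𝔽.- r) *ₗ w +ᴹ (r *ₗ w +ᴹ x)             ≈⟨ +ᴹ-assoc _ _ _ ⟨
            ((𝔽.- r) *ₗ w +ᴹ r *ₗ w) +ᴹ x             ≈⟨ +ᴹ-congʳ (cancel (𝔽.-‿inverseˡ r) w) ⟩
            0ᴹ +ᴹ x                                   ≈⟨ +ᴹ-identityˡ x ⟩
            x                                         ∎)
            where
            cancel : ∀ {a b} → a 𝔽.+ b 𝔽.≈ 𝔽.0# → ∀ z → a *ₗ z +ᴹ b *ₗ z ≈ᴹ 0ᴹ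
            cancel {a} {b} a+b≈0 z = begin
              a *ₗ z +ᴹ b *ₗ z  ≈⟨ *ₗ-distribʳ z a b ⟨
              (a 𝔽.+ b) *ₗ z    ≈⟨ *ₗ-congʳ a+b≈0 ⟩
              𝔽.0# *ₗ z         ≈⟨ *ₗ-zeroˡ z ⟩
              0ᴹ                ∎

            c₀⁻¹ = proj₁ (≉0⇒invertible c₀≉0)
            a    = proj₁ (U⊆v x∈)
            a₀   = a zero
            s′   = lincomb V (a ∘ suc) (v ∘ suc)
            r    = (𝔽.- a₀) 𝔽.* c₀⁻¹
            y    = r *ₗ w +ᴹ x

            rc₀≈-a₀ : r 𝔽.* c₀ 𝔽.≈ 𝔽.- a₀
            rc₀≈-a₀ = 𝔽.trans (𝔽.*-assoc _ _ _) (𝔽.trans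
              (𝔽.*-congˡ (proj₂ (≉0⇒invertible c₀≉0))) (𝔽.*-identityʳ _))

            y≈ : r *ₗ s +ᴹ s′ ≈ᴹ y
            y≈ = begin
              r *ₗ s +ᴹ s′                                ≈⟨ +ᴹ-identityˡ _ ⟨
              0ᴹ +ᴹ (r *ₗ s +ᴹ s′)                        ≈⟨ +ᴹ-congʳ (cancel
                (𝔽.trans (𝔽.+-congʳ rc₀≈-a₀) (𝔽.-‿inverseˡ a₀)) v₀) ⟨
              ((r 𝔽.* c₀) *ₗ v₀ +ᴹ a₀ *ₗ v₀) +ᴹ (r *ₗ s +ᴹ s′)
                                                          ≈⟨ medial _ _ _ _ ⟩
              ((r 𝔽.* c₀) *ₗ v₀ +ᴹ r *ₗ s) +ᴹ (a₀ *ₗ v₀ +ᴹ s′)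
                ≈⟨ +ᴹ-cong (+ᴹ-congʳ (*ₗ-assoc r c₀ v₀)) (proj₂ (U⊆v x∈)) ⟩
              (r *ₗ c₀ *ₗ v₀ +ᴹ r *ₗ s) +ᴹ x              ≈⟨ +ᴹ-congʳ (*ₗ-distribˡ r _ s) ⟨
              r *ₗ (c₀ *ₗ v₀ +ᴹ s) +ᴹ x                   ≈⟨ +ᴹ-congʳ (*ₗ-congˡ c≈w) ⟩
              r *ₗ w +ᴹ x                                 ∎
              where
              open CommutativeSemigroupProperties
                (CommutativeMonoid.commutativeSemigroup +ᴹ-commutativeMonoid)
                renaming (interchange to medial)

            y∈ : y U′.∈
            y∈ = U.+ᴹ-∈ (U.*ₗ-∈ r w∈) x∈ , tail.∈-resp-≈ᴹ y≈
                   (tail.+ᴹ-∈ (tail.*ₗ-∈ r (c ∘ suc , ≈ᴹ-refl)) (a ∘ suc , ≈ᴹ-refl))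
              where module tail = Subspace (span (v ∘ suc))

            d   = proj₁ (B.spanning y∈)
            d≈y = proj₂ (B.spanning y∈)

    module _ {V : VectorSpace} (V-fd : FiniteDimensional V) (U : Subspace V) where
      private
        open FiniteDimensional V-fd using (basis; isBasis)
        B = subBasis basis U (λ {x} _ → IsBasis.spanning isBasis x)
        module B = SubBasis B
        module V = LeftModule V

        inclusion : LinearMap (toSpace U) V
        inclusion = linearMap {toSpace U} {V} proj₁ (λ p → p)
          (λ _ _ → V.≈ᴹ-refl) (λ _ _ → V.≈ᴹ-refl)

        vec : Fin B.size → ∣ toSpace U ∣
        vec i = B.vec i , B.vec-∈ i

      subspace-fd : FiniteDimensional (toSpace U)
      subspace-fd = fd B.size vec record
        { independent = λ c c≈0 → B.independent c
            (V.≈ᴹ-trans (V.≈ᴹ-sym (map-lincomb inclusion c vec)) c≈0)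
        ; spanning    = λ (x , x∈) → let c , c≈x = B.spanning x∈ in
            c , V.≈ᴹ-trans (map-lincomb inclusion c vec) c≈x
        }

      dim-subspace-≤ : dim subspace-fd ℕ.≤ dim V-fd
      dim-subspace-≤ = B.size≤

record Digraph : Set where
  field
    #V #E     : ℕ
    tail head : Fin #E → Fin #V

module Sheaves {ℓ : Level} (𝔽 : HeytingField ℓ ℓ ℓ) (G : Digraph) where
  open LinearAlgebra 𝔽
  open Digraph G

  Vertex Edge Point : Set
  Vertex = Fin #V
  Edge   = Fin #E
  Point  = Vertex ⊎ Edge

  record Sheaf : Set (lsuc ℓ) where
    field
      value             : Point → VectorSpace
      finiteDimensional : ∀ P → FiniteDimensional (value P)
      restrictᵗ         : ∀ e → LinearMap (value (inj₂ e)) (value (inj₁ (tail e)))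
      restrictʰ         : ∀ e → LinearMap (value (inj₂ e)) (value (inj₁ (head e)))

    onV onE : VectorSpace
    onV = ⨁ (value ∘ inj₁)
    onE = ⨁ (value ∘ inj₂)

    onV-fd : FiniteDimensional onV
    onV-fd = ⨁-fd (finiteDimensional ∘ inj₁)

    onE-fd : FiniteDimensional onE
    onE-fd = ⨁-fd (finiteDimensional ∘ inj₂)

    χ : ℤ
    χ = + dim onV-fd ℤ.- + dim onE-fd

    dᵗ dʰ : LinearMap onE onV
    dᵗ = copair onV λ e → ι (value ∘ inj₁) (tail e) ∘ˡ restrictᵗ e
    dʰ = copair onV λ e → ι (value ∘ inj₁) (head e) ∘ˡ restrictʰ e

    -- ι embeds the summand F(e) in F(E), on which dʰ and dᵗ are defined.

    Γʰᵗ-at : Subspace onV → ∀ e → Subspace (value (inj₂ e))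
    Γʰᵗ-at U e = preimage (dʰ ∘ˡ ι (value ∘ inj₂) e) U ∩ preimage (dᵗ ∘ˡ ι (value ∘ inj₂) e) U

    Γʰᵗ : Subspace onV → VectorSpace
    Γʰᵗ U = ⨁ λ e → toSpace (Γʰᵗ-at U e)

    module _ (em : ExcludedMiddle ℓ) where

      Γʰᵗ-fd : ∀ U → FiniteDimensional (Γʰᵗ U)
      Γʰᵗ-fd U = ⨁-fd λ e → subspace-fd em (finiteDimensional (inj₂ e)) (Γʰᵗ-at U e)

      dim-Γʰᵗ-≤ : ∀ U → dim (Γʰᵗ-fd U) ℕ.≤ dim onE-fd
      dim-Γʰᵗ-≤ U = dim-⨁-mono _ (finiteDimensional ∘ inj₂) λ e →
        dim-subspace-≤ em (finiteDimensional (inj₂ e)) (Γʰᵗ-at U e)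

      excess : Subspace onV → ℤ
      excess U = + dim (Γʰᵗ-fd U) ℤ.- + dim (subspace-fd em onV-fd U)

  open Sheaf

  -- Excluded middle provides the dimensions of arbitrary subspaces and the
  -- maximum over all of them.

  module MaximumExcess (em : ExcludedMiddle (lsuc ℓ)) where

    emˡ : ExcludedMiddle ℓ
    emˡ {P} = Dec.map′ lower lift (em {Lift (lsuc ℓ) P})

    maximumExcess : (F : Sheaf) → ∃ (IsMaximum (excess F emˡ))
    maximumExcess F = maximum em (excess F emˡ) U₀ (dim (onE-fd F) ℕ.+ dim (subspace-fd emˡ (onV-fd F) U₀)) bound
      where
      open ℤ.≤-Reasoning
      open import Data.Integer.Solver using (module +-*-Solver)
      open +-*-Solver using (solve; _:+_; _:-_; _:=_)

      U₀   = zeroSubspace (onV F)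
      E    = dim (onE-fd F)
      γ₀   = dim (Γʰᵗ-fd F emˡ U₀)
      dim₀ = dim (subspace-fd emˡ (onV-fd F) U₀)

      bound : ∀ U → excess F emˡ U ℤ.≤ excess F emˡ U₀ ℤ.+ + (E ℕ.+ dim₀)
      bound U = begin
        excess F emˡ U                        ≤⟨ ℤ.i-j≤i _ (+ dim (subspace-fd emˡ (onV-fd F) U)) ⟩
        + dim (Γʰᵗ-fd F emˡ U)                ≤⟨ ℤ.+≤+ (dim-Γʰᵗ-≤ F emˡ U) ⟩
        + E                                   ≤⟨ ℤ.+≤+ (ℕ.m≤n+m E γ₀) ⟩
        + γ₀ ℤ.+ + E                          ≡⟨ solve 3 (λ g e d →
          g :+ e := (g :- d) :+ (e :+ d)) refl (+ γ₀) (+ E) (+ dim₀) ⟩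
        excess F emˡ U₀ ℤ.+ + (E ℕ.+ dim₀)    ∎

    m-e : Sheaf → ℤ
    m-e F = proj₁ (maximumExcess F)

    α₁ α₀ : Sheaf → ℤ
    α₁ F = m-e F
    α₀ F = χ F ℤ.+ m-e F

  record Morphism (F F′ : Sheaf) : Set ℓ where
    private
      module F  = Sheaf F
      module F′ = Sheaf F′
    field
      map         : ∀ P → LinearMap (F.value P) (F′.value P)
      commutesᵗ   : ∀ e x → LeftModule._≈ᴹ_ (F′.value (inj₁ (tail e)))
                              (⟦ F′.restrictᵗ e ⟧ (⟦ map (inj₂ e) ⟧ x))
                              (⟦ map (inj₁ (tail e)) ⟧ (⟦ F.restrictᵗ e ⟧ x))
      commutesʰ   : ∀ e x → LeftModule._≈ᴹ_ (F′.value (inj₁ (head e)))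
                              (⟦ F′.restrictʰ e ⟧ (⟦ map (inj₂ e) ⟧ x))
                              (⟦ map (inj₁ (head e)) ⟧ (⟦ F.restrictʰ e ⟧ x))

  _⊕_ : Sheaf → Sheaf → Sheaf
  F ⊕ F′ = record
    { value             = λ P → value F P ×ᵛ value F′ P
    ; finiteDimensional = λ P → ×ᵛ-fd (finiteDimensional F P) (finiteDimensional F′ P)
    ; restrictᵗ         = λ e → restrictᵗ F e ×ˡ restrictᵗ F′ e
    ; restrictʰ         = λ e → restrictʰ F e ×ˡ restrictʰ F′ e
    }

  record ShortExact (F₁ F₂ F₃ : Sheaf) : Set ℓ where
    field
      α : Morphism F₁ F₂
      β : Morphism F₂ F₃
    private
      module α = Morphism α
      module β = Morphism β
      module V₁ (P : Point) = LeftModule (value F₁ P)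
      module V₂ (P : Point) = LeftModule (value F₂ P)
      module V₃ (P : Point) = LeftModule (value F₃ P)
    field
      injective  : ∀ P → Injective (V₁._≈ᴹ_ P) (V₂._≈ᴹ_ P) ⟦ α.map P ⟧
      exact      : ∀ P y → V₃._≈ᴹ_ P (⟦ β.map P ⟧ y) (V₃.0ᴹ P) ⇔
                           (∃[ x ] V₂._≈ᴹ_ P (⟦ α.map P ⟧ x) y)
      surjective : ∀ P → Surjective (V₂._≈ᴹ_ P) (V₃._≈ᴹ_ P) ⟦ β.map P ⟧

{-# OPTIONS --safe #-}

-- A subspace U of F(V) together with Γʰᵗ(U) is a subsheaf of F, and its excess is −χ of that
-- subsheaf, so m.e.(F) is the maximum of the additive function −χ over subsheaves. For
-- 0 → F₁ → F₂ → F₃ → 0, a subsheaf of F₁ is one of F₂; a subsheaf of F₂ splits into its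
-- intersection with F₁ and its image in F₃; and the preimage in F₂ of a subsheaf of F₃ changes
-- −χ by −χ(F₁), whence m.e.(F₃) ≤ χ(F₁) + m.e.(F₂). Since m.e. ≥ 0 and χ + m.e. ≥ 0 (take U = 0
-- and U = F(V)), all six inequalities follow by arithmetic.

module Submission where

open import Defs
open import Algebra.Apartness.Bundles using (HeytingField)
import Algebra.Apartness.Properties.HeytingCommutativeRing as HeytingCommutativeRingProperties
open import Algebra.Bundles using (CommutativeMonoid)
open import Algebra.Module.Bundles using (LeftModule)
import Algebra.Properties.CommutativeMonoid.Sum as Sum
import Algebra.Properties.CommutativeSemigroup as CommutativeSemigroupProperties
open import Axiom.ExcludedMiddle using (ExcludedMiddle)
open import Data.Empty using (⊥-elim)
open import Data.Fin.Base using (Fin; zero; suc; _↑ˡ_; _↑ʳ_; splitAt; join; punchIn)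
open import Data.Fin.Properties using (any?; join-splitAt) renaming (_≟_ to _≟ᶠ_)
open import Data.Integer.Base as ℤ using (ℤ; 0ℤ; +_; +≤+; _+_; _-_; _≤_)
import Data.Integer.Properties as ℤ
open import Data.Integer.Solver using (module +-*-Solver)
open import Data.List.Base using ([]; _∷_)
open import Data.Nat.Base as ℕ using (ℕ; zero; suc; z≤n; s≤s)
import Data.Nat.Properties as ℕ
open import Data.Product.Base using (∃-syntax; Σ-syntax; _×_; _,_; proj₁; proj₂)
open import Data.Sum.Base using (inj₁; inj₂)
open import Data.Unit.Polymorphic.Base using (tt)
open import Data.Vec.Functional using (_++_; insertAt) renaming (_∷_ to _∷ᵛ_)
import Data.Vec.Functional.Properties as Vec
open import Function.Base using (_∘_; id)
open import Function.Bundles using (Equivalence; mk⇔)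
open import Level using (Level) renaming (suc to lsuc)
open import Relation.Binary.PropositionalEquality as ≡ using (_≡_; refl)
import Relation.Binary.Reasoning.Setoid as SetoidReasoning
open import Relation.Nullary using (¬_; Dec; yes; no)
import Relation.Nullary.Decidable as Dec

-- The length of a carried basis serves as dimension, and bases of subspaces are picked through
-- excluded middle, so equal dimensions need not agree by computation. Comparisons that do not
-- follow from how bases are built therefore rest on the exchange lemma, and rank-nullity appears as
-- two inequalities. This suits the excess, which is a difference: bounding it takes one half for
-- the edge part and the opposite half for the vertex part. Additivity on direct sums combines two
-- sources. One inequality is the bound for short exact sequences; the other needs a subspace for
-- the middle sheaf assembled from arbitrary subspaces for the outer two, which becomes possible
-- once the sequence has a retraction.

private
  variable
    m n : ℕ

-- Linear maps, subspaces and naturality of finite direct sums.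

module LinearAlgebraProperties {ℓ : Level} (𝔽 : HeytingField ℓ ℓ ℓ) where

  open LinearAlgebra 𝔽

  private
    module 𝔽 = HeytingField 𝔽
    open 𝔽 using () renaming (Carrier to Scalar)

  module _ {V W : VectorSpace} (f : LinearMap V W) where
    private
      module V = LeftModule V
      module W = LeftModule W
      module f = LinearMap f
      module ΣV = Sum V.+ᴹ-commutativeMonoid
      module ΣW = Sum W.+ᴹ-commutativeMonoid

    map-sum : (x : Fin n → ∣ V ∣) → ⟦ f ⟧ (ΣV.sum x) W.≈ᴹ ΣW.sum (⟦ f ⟧ ∘ x)
    map-sum {zero}  x = f.0ᴹ-homo
    map-sum {suc n} x = W.≈ᴹ-trans (f.+ᴹ-homo _ _) (W.+ᴹ-congˡ (map-sum (x ∘ suc)))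

    image : Subspace W
    image = record
      { _∈        = λ y → ∃[ x ] ⟦ f ⟧ x W.≈ᴹ y
      ; ∈-resp-≈ᴹ = λ y≈z (x , p) → x , W.≈ᴹ-trans p y≈z
      ; 0ᴹ-∈      = V.0ᴹ , f.0ᴹ-homo
      ; +ᴹ-∈      = λ (x , p) (y , q) → x V.+ᴹ y , W.≈ᴹ-trans (f.+ᴹ-homo x y) (W.+ᴹ-cong p q)
      ; *ₗ-∈      = λ a (x , p) → a V.*ₗ x , W.≈ᴹ-trans (f.*ₗ-homo a x) (W.*ₗ-congˡ p)
      }

    corestrict : (U : Subspace W) (let open Subspace U) →
                 (∀ x → ⟦ f ⟧ x ∈) → LinearMap V (toSpace U)
    corestrict U f∈ = linearMap {V} {toSpace U} (λ x → ⟦ f ⟧ x , f∈ x)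
      f.⟦⟧-cong f.+ᴹ-homo f.*ₗ-homo

  inclusion : ∀ {V} (U : Subspace V) → LinearMap (toSpace U) V
  inclusion {V} U = linearMap {toSpace U} {V} proj₁ id (λ _ _ → ≈ᴹ-refl) (λ _ _ → ≈ᴹ-refl)
    where open LeftModule V

  restrict : ∀ {V W} (f : LinearMap V W) (U : Subspace V) (U′ : Subspace W) →
             (∀ {x} → Subspace._∈ U x → Subspace._∈ U′ (⟦ f ⟧ x)) →
             LinearMap (toSpace U) (toSpace U′)
  restrict f U U′ f∈ = corestrict (f ∘ˡ inclusion U) U′ λ (_ , x∈) → f∈ x∈

  identity : (V : VectorSpace) → LinearMap V V
  identity V = linearMap {V} {V} id id (λ _ _ → ≈ᴹ-refl) (λ _ _ → ≈ᴹ-refl)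
    where open LeftModule V

  -- Encoded as an image so that closure is inherited from `image`; every vector is its own witness
  -- of membership.
  fullSubspace : (V : VectorSpace) → Subspace V
  fullSubspace V = image (identity V)

  module _ {V W : Fin n → VectorSpace} (f : ∀ i → LinearMap (V i) (W i)) where
    private
      module W (i : Fin n) = LeftModule (W i)
      module f (i : Fin n) = LinearMap (f i)

    ⨁-map : LinearMap (⨁ V) (⨁ W)
    ⨁-map = linearMap {⨁ V} {⨁ W} (λ x i → ⟦ f i ⟧ (x i))
      (λ p i → f.⟦⟧-cong i (p i))
      (λ x y i → f.+ᴹ-homo i (x i) (y i))
      (λ a x i → f.*ₗ-homo i a (x i))

    ι-natural : ∀ i x → LeftModule._≈ᴹ_ (⨁ W)
      (⟦ ⨁-map ⟧ (⟦ ι V i ⟧ x)) (⟦ ι W i ⟧ (⟦ f i ⟧ x))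
    ι-natural i x j with i ≟ᶠ j
    ... | yes refl = W.≈ᴹ-refl i
    ... | no _     = f.0ᴹ-homo j

    copair-natural : {X Y : VectorSpace} (g : LinearMap X Y)
      (p : ∀ i → LinearMap (V i) X) (q : ∀ i → LinearMap (W i) Y) →
      (let module Y = LeftModule Y) →
      (∀ i x → ⟦ g ⟧ (⟦ p i ⟧ x) Y.≈ᴹ ⟦ q i ⟧ (⟦ f i ⟧ x)) →
      ∀ x → ⟦ g ⟧ (⟦ copair X p ⟧ x) Y.≈ᴹ ⟦ copair Y q ⟧ (⟦ ⨁-map ⟧ x)
    copair-natural {X} {Y} g p q gp≈qf x = Y.≈ᴹ-trans
      (map-sum g (λ i → ⟦ p i ⟧ (x i)))
      (Sum.sum-cong-≋ Y.+ᴹ-commutativeMonoid λ i → gp≈qf i (x i))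
      where module Y = LeftModule Y

  -- The exchange lemma and dimension counts.

  module _ (V : VectorSpace) where
    open LeftModule V
    open SetoidReasoning ≈ᴹ-setoid

    Independent : (Fin n → ∣ V ∣) → Set ℓ
    Independent v = ∀ c → lincomb V c v ≈ᴹ 0ᴹ → ∀ i → c i 𝔽.≈ 𝔽.0#

    lincomb-tail : ∀ c (w : Fin (suc n) → ∣ V ∣) → c zero 𝔽.≈ 𝔽.0# →
                   lincomb V c w ≈ᴹ lincomb V (c ∘ suc) (w ∘ suc)
    lincomb-tail c w c₀≈0 = ≈ᴹ-trans
      (+ᴹ-congʳ (≈ᴹ-trans (*ₗ-congʳ c₀≈0) (*ₗ-zeroˡ _))) (+ᴹ-identityˡ _)

    -- `ρ` is the sum of the products of the entries of `d` and `r`; it stays existential because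
    -- `independent-shear` only needs some coefficient for `x`.
    lincomb-shear : ∀ (d r : Fin n → Scalar) (u : Fin n → ∣ V ∣) x →
      ∃[ ρ ] lincomb V d (λ i → u i +ᴹ r i *ₗ x) ≈ᴹ ρ *ₗ x +ᴹ lincomb V d u
    lincomb-shear {zero}  d r u x = 𝔽.0# ,
      ≈ᴹ-sym (≈ᴹ-trans (+ᴹ-identityʳ _) (*ₗ-zeroˡ x))
    lincomb-shear {suc n} d r u x =
      let ρ , eq = lincomb-shear (d ∘ suc) (r ∘ suc) (u ∘ suc) x
          d₀ = d zero; r₀ = r zero; u₀ = u zero
          L  = lincomb V (d ∘ suc) (u ∘ suc)
      in d₀ 𝔽.* r₀ 𝔽.+ ρ , (begin
        d₀ *ₗ (u₀ +ᴹ r₀ *ₗ x) +ᴹ lincomb V (d ∘ suc) _           ≈⟨ +ᴹ-cong (*ₗ-distribˡ d₀ u₀ _) eq ⟩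
        (d₀ *ₗ u₀ +ᴹ d₀ *ₗ r₀ *ₗ x) +ᴹ (ρ *ₗ x +ᴹ L)             ≈⟨ +ᴹ-congʳ (+ᴹ-comm _ _) ⟩
        (d₀ *ₗ r₀ *ₗ x +ᴹ d₀ *ₗ u₀) +ᴹ (ρ *ₗ x +ᴹ L)             ≈⟨ interchange _ _ _ _ ⟩
        (d₀ *ₗ r₀ *ₗ x +ᴹ ρ *ₗ x) +ᴹ (d₀ *ₗ u₀ +ᴹ L)
          ≈⟨ +ᴹ-congʳ (≈ᴹ-trans (*ₗ-distribʳ x _ ρ) (+ᴹ-congʳ (*ₗ-assoc d₀ r₀ x))) ⟨
        (d₀ 𝔽.* r₀ 𝔽.+ ρ) *ₗ x +ᴹ (d₀ *ₗ u₀ +ᴹ L)                ∎)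
      where
      open CommutativeSemigroupProperties
        (CommutativeMonoid.commutativeSemigroup +ᴹ-commutativeMonoid) using (interchange)

    -- A relation `d` among the sheared vectors becomes one among `v` by inserting at position `k`
    -- the total multiple of `v k` that it contains; independence of `v` then kills every entry of
    -- `d`.
    independent-shear : ∀ k (r : Fin n → Scalar) {v : Fin (suc n) → ∣ V ∣} → Independent v →
                        Independent (λ i → v (punchIn k i) +ᴹ r i *ₗ v k)
    independent-shear k r {v} indep d d≈0 i = 𝔽.trans
      (𝔽.sym (𝔽.reflexive (Vec.insertAt-punchIn d k ρ i))) (indep e e≈0 (punchIn k i))
      where
      u = v ∘ punchIn k
      ρ = proj₁ (lincomb-shear d r u (v k))
      e = insertAt d k ρ

      e≈0 : lincomb V e v ≈ᴹ 0ᴹ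
      e≈0 = begin
        lincomb V e v
          ≈⟨ Sum.sum-remove +ᴹ-commutativeMonoid {i = k} (λ i → e i *ₗ v i) ⟩
        e k *ₗ v k +ᴹ lincomb V (e ∘ punchIn k) u
          ≈⟨ +ᴹ-cong (*ₗ-congʳ (𝔽.reflexive (Vec.insertAt-lookup d k ρ)))
                     (lincomb-cong V {b = u} (λ i → 𝔽.reflexive (Vec.insertAt-punchIn d k ρ i)) λ _ → ≈ᴹ-refl) ⟩
        ρ *ₗ v k +ᴹ lincomb V d u                ≈⟨ proj₂ (lincomb-shear d r u (v k)) ⟨
        lincomb V d (λ i → u i +ᴹ r i *ₗ v k)    ≈⟨ d≈0 ⟩
        0ᴹ                                       ∎

  module _ (em : ExcludedMiddle ℓ) where

    -- Some v k involving w zero is used to eliminate w zero from the others.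
    steinitz : ∀ (V : VectorSpace) {v : Fin m → ∣ V ∣} {w : Fin n → ∣ V ∣}
               (let open LeftModule V) → Independent V v →
               (∀ i → ∃[ c ] lincomb V c w ≈ᴹ v i) → m ℕ.≤ n
    steinitz {zero}          V indep spans = z≤n
    steinitz {suc m} {zero}  V {v} indep spans = ⊥-elim (𝔽.#-irrefl 1≈0 1#0)
      where
      open LeftModule V
      open HeytingCommutativeRingProperties 𝔽.heytingCommutativeRing using (1#0)

      -- Since `w` is empty, `v zero` equals the empty sum, so the coefficients 1, 0, ..., 0 form a
      -- relation among the `v`.
      1≈0 : 𝔽.1# 𝔽.≈ 𝔽.0#
      1≈0 = indep (𝔽.1# ∷ᵛ λ _ → 𝔽.0#) (≈ᴹ-trans
        (+ᴹ-cong (*ₗ-identityˡ (v zero)) (lincomb-zeroˡ V (v ∘ suc)))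
        (≈ᴹ-trans (+ᴹ-identityʳ _) (≈ᴹ-sym (proj₂ (spans zero))))) zero
    steinitz {suc m} {suc n} V {v} {w} indep spans = reduce (any? λ i → em)
      where
      open LeftModule V

      c : Fin (suc m) → Fin (suc n) → Scalar
      c i = proj₁ (spans i)

      reduce : Dec (∃[ k ] ¬ c k zero 𝔽.≈ 𝔽.0#) → suc m ℕ.≤ suc n
      reduce (no ¬∃) = ℕ.m≤n⇒m≤1+n (steinitz V {w = w ∘ suc} indep λ i → c i ∘ suc , ≈ᴹ-trans
        (≈ᴹ-sym (lincomb-tail V (c i) w (Dec.decidable-stable em λ c≉0 → ¬∃ (i , c≉0))))
        (proj₂ (spans i)))
      reduce (yes (k , cₖ≉0)) = s≤s (steinitz V (independent-shear V k r {v} indep) λ i →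
        (λ j → c (punchIn k i) (suc j) 𝔽.+ r i 𝔽.* c k (suc j)) , spans′ i)
        where
        b = proj₁ (≉0⇒invertible em cₖ≉0)

        r : Fin m → Scalar
        r i = 𝔽.- c (punchIn k i) zero 𝔽.* b

        eliminated : ∀ i → c (punchIn k i) zero 𝔽.+ r i 𝔽.* c k zero 𝔽.≈ 𝔽.0#
        eliminated i = 𝔽.trans (𝔽.+-congˡ (𝔽.trans (𝔽.*-assoc _ _ _) (𝔽.trans
          (𝔽.*-congˡ (proj₂ (≉0⇒invertible em cₖ≉0))) (𝔽.*-identityʳ _)))) (𝔽.-‿inverseʳ _)

        spans′ : ∀ i → lincomb V (λ j → c (punchIn k i) (suc j) 𝔽.+ r i 𝔽.* c k (suc j)) (w ∘ suc)
                       ≈ᴹ v (punchIn k i) +ᴹ r i *ₗ v k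
        spans′ i = begin
          lincomb V (e ∘ suc) (w ∘ suc)                  ≈⟨ lincomb-tail V e w (eliminated i) ⟨
          lincomb V e w                                  ≈⟨ lincomb-+ V (c (punchIn k i)) (λ j → r i 𝔽.* c k j) w ⟩
          lincomb V (c (punchIn k i)) w +ᴹ lincomb V (λ j → r i 𝔽.* c k j) w
            ≈⟨ +ᴹ-cong (proj₂ (spans (punchIn k i)))
                       (≈ᴹ-trans (lincomb-* V (r i) (c k) w) (*ₗ-congˡ (proj₂ (spans k)))) ⟩
          v (punchIn k i) +ᴹ r i *ₗ v k                  ∎
          where
          open SetoidReasoning ≈ᴹ-setoid
          e : Fin (suc n) → Scalar
          e j = c (punchIn k i) j 𝔽.+ r i 𝔽.* c k j

    module _ {V : VectorSpace} (V-fd : FiniteDimensional V) where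
      open LeftModule V
      open FiniteDimensional V-fd using (basis; isBasis)

      -- Together with `spanning⇒dim≤` this detaches `dim` from the basis that defines it: any
      -- independent or spanning family gives a bound.
      independent⇒≤dim : {v : Fin m → ∣ V ∣} → Independent V v → m ℕ.≤ dim V-fd
      independent⇒≤dim {v = v} indep = steinitz V indep λ i → IsBasis.spanning isBasis (v i)

      spanning⇒dim≤ : {w : Fin n → ∣ V ∣} → (∀ x → ∃[ c ] lincomb V c w ≈ᴹ x) → dim V-fd ℕ.≤ n
      spanning⇒dim≤ spans = steinitz V (IsBasis.independent isBasis) λ i → spans (basis i)

    module _ {V W : VectorSpace} (V-fd : FiniteDimensional V) (W-fd : FiniteDimensional W)
             (f : LinearMap V W) where
      private
        module V = LeftModule V
        module W = LeftModule W
        module f = LinearMap f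
        open FiniteDimensional V-fd using (basis; isBasis)
        open IsBasis isBasis

      injective⇒dim≤ : (∀ x → ⟦ f ⟧ x W.≈ᴹ W.0ᴹ → x V.≈ᴹ V.0ᴹ) → dim V-fd ℕ.≤ dim W-fd
      injective⇒dim≤ ker≈0 = independent⇒≤dim W-fd λ c c≈0 → independent c
        (ker≈0 _ (W.≈ᴹ-trans (map-lincomb f c basis) c≈0))

      surjective⇒dim≤ : (∀ y → ∃[ x ] ⟦ f ⟧ x W.≈ᴹ y) → dim W-fd ℕ.≤ dim V-fd
      surjective⇒dim≤ surj = spanning⇒dim≤ W-fd λ y →
        let x , fx≈y = surj y
            c , c≈x  = spanning x
        in c , W.≈ᴹ-trans (W.≈ᴹ-sym (map-lincomb f c basis)) (W.≈ᴹ-trans (f.⟦⟧-cong c≈x) fx≈y)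

    module _ {U V W : VectorSpace} (U-fd : FiniteDimensional U) (V-fd : FiniteDimensional V)
             (W-fd : FiniteDimensional W) (f : LinearMap U V) (g : LinearMap V W) where
      private
        module U = LeftModule U
        module V = LeftModule V
        module W = LeftModule W
        module f = LinearMap f
        module g = LinearMap g

      open FiniteDimensional U-fd using () renaming (basis to u; isBasis to u-basis)

      -- The lower half of rank-nullity. Images of a basis of `U` and lifts of a basis of `W` are
      -- jointly independent: `g` erases the first group, so the coefficients of the lifts vanish,
      -- and then injectivity of `f` clears the rest.
      dim-superadditive : (∀ x → ⟦ f ⟧ x V.≈ᴹ V.0ᴹ → x U.≈ᴹ U.0ᴹ) →
                          (∀ x → ⟦ g ⟧ (⟦ f ⟧ x) W.≈ᴹ W.0ᴹ) →
                          (∀ z → ∃[ y ] ⟦ g ⟧ y W.≈ᴹ z) →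
                          dim U-fd ℕ.+ dim W-fd ℕ.≤ dim V-fd
      dim-superadditive ker≈0 gf≈0 surj = independent⇒≤dim V-fd {v = fu++v} λ c c≈0 k →
        ≡.subst (λ k → c k 𝔽.≈ 𝔽.0#) (join-splitAt p q k) (indep c c≈0 (splitAt p k))
        where
        open FiniteDimensional W-fd using () renaming (basis to w; isBasis to w-basis)
        p = dim U-fd
        q = dim W-fd

        v : Fin q → ∣ V ∣
        v j = proj₁ (surj (w j))

        fu++v : Fin (p ℕ.+ q) → ∣ V ∣
        fu++v = (⟦ f ⟧ ∘ u) ++ v

        module _ (c : Fin (p ℕ.+ q) → Scalar) (c≈0 : lincomb V c fu++v V.≈ᴹ V.0ᴹ) where
          c₁ = λ i → c (i ↑ˡ q)
          c₂ = λ j → c (p ↑ʳ j)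
          x  = lincomb U c₁ u
          y  = lincomb V c₂ v

          fx+y≈0 : ⟦ f ⟧ x V.+ᴹ y V.≈ᴹ V.0ᴹ
          fx+y≈0 = begin
            ⟦ f ⟧ x V.+ᴹ y                         ≈⟨ V.+ᴹ-congʳ (map-lincomb f c₁ u) ⟩
            lincomb V c₁ (⟦ f ⟧ ∘ u) V.+ᴹ y        ≈⟨ V.+ᴹ-cong
              (lincomb-cong V {c = c₁} (λ _ → 𝔽.refl) λ i →
                V.≈ᴹ-reflexive (Vec.lookup-++ˡ (⟦ f ⟧ ∘ u) v i))
              (lincomb-cong V {c = c₂} (λ _ → 𝔽.refl) λ j →
                V.≈ᴹ-reflexive (Vec.lookup-++ʳ (⟦ f ⟧ ∘ u) v j)) ⟨
            _                                      ≈⟨ lincomb-split V {p} c fu++v ⟨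
            lincomb V c fu++v                      ≈⟨ c≈0 ⟩
            V.0ᴹ                                   ∎
            where open SetoidReasoning V.≈ᴹ-setoid

          c₂≈0 : ∀ j → c₂ j 𝔽.≈ 𝔽.0#
          c₂≈0 = IsBasis.independent w-basis c₂ (begin
            lincomb W c₂ w                         ≈⟨ lincomb-cong W {c = c₂} (λ _ → 𝔽.refl) (proj₂ ∘ surj ∘ w) ⟨
            lincomb W c₂ (⟦ g ⟧ ∘ v)               ≈⟨ map-lincomb g c₂ v ⟨
            ⟦ g ⟧ y                                ≈⟨ W.+ᴹ-identityˡ _ ⟨
            W.0ᴹ W.+ᴹ ⟦ g ⟧ y                      ≈⟨ W.+ᴹ-congʳ (gf≈0 x) ⟨
            ⟦ g ⟧ (⟦ f ⟧ x) W.+ᴹ ⟦ g ⟧ y           ≈⟨ g.+ᴹ-homo _ _ ⟨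
            ⟦ g ⟧ (⟦ f ⟧ x V.+ᴹ y)                 ≈⟨ g.⟦⟧-cong fx+y≈0 ⟩
            ⟦ g ⟧ V.0ᴹ                             ≈⟨ g.0ᴹ-homo ⟩
            W.0ᴹ                                   ∎)
            where
            open SetoidReasoning W.≈ᴹ-setoid

          y≈0 : y V.≈ᴹ V.0ᴹ
          y≈0 = V.≈ᴹ-trans (lincomb-cong V {b = v} c₂≈0 λ _ → V.≈ᴹ-refl) (lincomb-zeroˡ V v)

          c₁≈0 : ∀ i → c₁ i 𝔽.≈ 𝔽.0#
          c₁≈0 = IsBasis.independent u-basis c₁ (ker≈0 x (begin
            ⟦ f ⟧ x                 ≈⟨ V.+ᴹ-identityʳ _ ⟨
            ⟦ f ⟧ x V.+ᴹ V.0ᴹ       ≈⟨ V.+ᴹ-congˡ y≈0 ⟨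
            ⟦ f ⟧ x V.+ᴹ y          ≈⟨ fx+y≈0 ⟩
            V.0ᴹ                    ∎))
            where open SetoidReasoning V.≈ᴹ-setoid

          indep : ∀ k → c (join p q k) 𝔽.≈ 𝔽.0#
          indep (inj₁ i) = c₁≈0 i
          indep (inj₂ j) = c₂≈0 j

      -- The upper half of rank-nullity. Only vectors in the image of `g` can be lifted, so the
      -- spanning family of `V` uses a basis of that image, whose length is at most the dimension of
      -- `W`.
      dim-subadditive : (∀ y → ⟦ g ⟧ y W.≈ᴹ W.0ᴹ → ∃[ x ] ⟦ f ⟧ x V.≈ᴹ y) →
                        dim V-fd ℕ.≤ dim U-fd ℕ.+ dim W-fd
      dim-subadditive exact = ℕ.≤-trans
        (spanning⇒dim≤ V-fd {w = (⟦ f ⟧ ∘ u) ++ v} spans)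
        (ℕ.+-monoʳ-≤ (dim U-fd) (dim-subspace-≤ em W-fd (image g)))
        where
        image-fd = subspace-fd em W-fd (image g)
        open FiniteDimensional image-fd using () renaming (basis to w; isBasis to w-basis)

        -- A member of `image g` carries a preimage, so the lifts are read off from the membership
        -- proofs.
        v : Fin (dim image-fd) → ∣ V ∣
        v j = proj₁ (proj₂ (w j))

        spans : ∀ y → ∃[ c ] lincomb V c ((⟦ f ⟧ ∘ u) ++ v) V.≈ᴹ y
        spans y = c ++ d , (begin
          lincomb V (c ++ d) ((⟦ f ⟧ ∘ u) ++ v)            ≈⟨ lincomb-++ V c d (⟦ f ⟧ ∘ u) v ⟩
          lincomb V c (⟦ f ⟧ ∘ u) V.+ᴹ y′                  ≈⟨ V.+ᴹ-congʳ (map-lincomb f c u) ⟨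
          ⟦ f ⟧ (lincomb U c u) V.+ᴹ y′                    ≈⟨ V.+ᴹ-congʳ (f.⟦⟧-cong c≈x) ⟩
          ⟦ f ⟧ x V.+ᴹ y′                                  ≈⟨ V.+ᴹ-congʳ fx≈y-y′ ⟩
          (y V.+ᴹ V.-ᴹ y′) V.+ᴹ y′                         ≈⟨ V.+ᴹ-assoc _ _ _ ⟩
          y V.+ᴹ (V.-ᴹ y′ V.+ᴹ y′)                         ≈⟨ V.+ᴹ-congˡ (V.-ᴹ‿inverseˡ y′) ⟩
          y V.+ᴹ V.0ᴹ                                      ≈⟨ V.+ᴹ-identityʳ y ⟩
          y                                                ∎)
          where
          open SetoidReasoning V.≈ᴹ-setoid
          -- The lift `y′` built from the coordinates of `g y` has the same image as `y`, so
          -- exactness places their difference in the image of `f`.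
          d    = proj₁ (IsBasis.spanning w-basis (⟦ g ⟧ y , y , W.≈ᴹ-refl))
          d≈gy = proj₂ (IsBasis.spanning w-basis (⟦ g ⟧ y , y , W.≈ᴹ-refl))
          y′   = lincomb V d v

          gy′≈gy : ⟦ g ⟧ y′ W.≈ᴹ ⟦ g ⟧ y
          gy′≈gy = W.≈ᴹ-trans (map-lincomb g d v) (W.≈ᴹ-trans
            (lincomb-cong W {c = d} (λ _ → 𝔽.refl) λ j → proj₂ (proj₂ (w j)))
            (W.≈ᴹ-trans (W.≈ᴹ-sym (map-lincomb (inclusion (image g)) d w)) d≈gy))

          g≈0 : ⟦ g ⟧ (y V.+ᴹ V.-ᴹ y′) W.≈ᴹ W.0ᴹ
          g≈0 = W.≈ᴹ-trans (g.+ᴹ-homo y _) (W.≈ᴹ-trans (W.+ᴹ-congʳ (W.≈ᴹ-sym gy′≈gy))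
            (W.≈ᴹ-trans (W.≈ᴹ-sym (g.+ᴹ-homo y′ _))
            (W.≈ᴹ-trans (g.⟦⟧-cong (V.-ᴹ‿inverseʳ y′)) g.0ᴹ-homo)))

          x       = proj₁ (exact _ g≈0)
          fx≈y-y′ = proj₂ (exact _ g≈0)
          c       = proj₁ (IsBasis.spanning u-basis x)
          c≈x     = proj₂ (IsBasis.spanning u-basis x)

    -- The basis comes from excluded middle, so its length does not compute to 0; it is bounded by
    -- that of the empty family, which spans.
    dim-zeroSubspace : {V : VectorSpace} (V-fd : FiniteDimensional V) →
                       dim (subspace-fd em V-fd (zeroSubspace V)) ≡ 0
    dim-zeroSubspace {V} V-fd = ℕ.n≤0⇒n≡0 (spanning⇒dim≤ (subspace-fd em V-fd (zeroSubspace V))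
      {w = λ ()} λ (x , x≈0) → (λ ()) , LeftModule.≈ᴹ-sym V x≈0)

  -- Realises summandwise sums of dimensions as dimensions of product spaces, so that `dim-⨁-mono`
  -- also handles bounds that are sums.
  dim-⨁-+ : {U W : Fin n → VectorSpace}
            (U-fd : ∀ i → FiniteDimensional (U i)) (W-fd : ∀ i → FiniteDimensional (W i)) →
            dim (⨁-fd λ i → ×ᵛ-fd (U-fd i) (W-fd i)) ≡ dim (⨁-fd U-fd) ℕ.+ dim (⨁-fd W-fd)
  dim-⨁-+ {zero}  U-fd W-fd = refl
  dim-⨁-+ {suc n} U-fd W-fd = ≡.trans
    (≡.cong (_ ℕ.+_) (dim-⨁-+ (U-fd ∘ suc) (W-fd ∘ suc)))
    (interchange (dim (U-fd zero)) _ _ _)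
    where open CommutativeSemigroupProperties ℕ.+-commutativeSemigroup using (interchange)

  dim-⨁-cong : {V W : Fin n → VectorSpace}
               (V-fd : ∀ i → FiniteDimensional (V i)) (W-fd : ∀ i → FiniteDimensional (W i)) →
               (∀ i → dim (V-fd i) ≡ dim (W-fd i)) → dim (⨁-fd V-fd) ≡ dim (⨁-fd W-fd)
  dim-⨁-cong {zero}  V-fd W-fd eq = refl
  dim-⨁-cong {suc n} V-fd W-fd eq =
    ≡.cong₂ ℕ._+_ (eq zero) (dim-⨁-cong (V-fd ∘ suc) (W-fd ∘ suc) (eq ∘ suc))

  module _ {U V W : Fin n → VectorSpace} (U-fd : ∀ i → FiniteDimensional (U i))
           (V-fd : ∀ i → FiniteDimensional (V i)) (W-fd : ∀ i → FiniteDimensional (W i)) where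

    dim-⨁-subadditive : (∀ i → dim (V-fd i) ℕ.≤ dim (U-fd i) ℕ.+ dim (W-fd i)) →
                        dim (⨁-fd V-fd) ℕ.≤ dim (⨁-fd U-fd) ℕ.+ dim (⨁-fd W-fd)
    dim-⨁-subadditive le = ℕ.≤-trans (dim-⨁-mono V-fd _ le) (ℕ.≤-reflexive (dim-⨁-+ U-fd W-fd))

    dim-⨁-superadditive : (∀ i → dim (U-fd i) ℕ.+ dim (W-fd i) ℕ.≤ dim (V-fd i)) →
                          dim (⨁-fd U-fd) ℕ.+ dim (⨁-fd W-fd) ℕ.≤ dim (⨁-fd V-fd)
    dim-⨁-superadditive le = ℕ.≤-trans (ℕ.≤-reflexive (≡.sym (dim-⨁-+ U-fd W-fd)))
      (dim-⨁-mono _ V-fd le)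

-- Integer arithmetic for maxima, differences of dimensions and triangular sequences.

open CommutativeSemigroupProperties ℤ.+-commutativeSemigroup using ()
  renaming (interchange to ℤ-interchange)
open +-*-Solver using (solve; _:+_; _:-_; _:=_; con)

regroup : ∀ a b d e → (a + b) - (d + e) ≡ (a - d) + (b - e)
regroup = solve 4 (λ a b d e → (a :+ b) :- (d :+ e) := (a :- d) :+ (b :- e)) refl

-- Serves to identify `k` with `α₁ F₂` in `α₁-split`.
isMaximum-unique : ∀ {a} {A : Set a} {f : A → ℤ} {k l} → IsMaximum f k → IsMaximum f l → k ≡ l
isMaximum-unique p q = ℤ.≤-antisym (below p q) (below q p)
  where
  below : ∀ {k l} → IsMaximum _ k → IsMaximum _ l → k ≤ l
  below p q = let x , fx≡k = IsMaximum.attained p in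
    ℤ.≤-trans (ℤ.≤-reflexive (≡.sym fx≡k)) (IsMaximum.isUpper q x)

isMaximum-cong : ∀ {a} {A : Set a} {f g : A → ℤ} {k} → IsMaximum f k →
                 (∀ x → f x ≡ g x) → IsMaximum g k
isMaximum-cong p f≗g = record
  { attained = let x , fx≡k = IsMaximum.attained p in x , ≡.trans (≡.sym (f≗g x)) fx≡k
  ; isUpper  = λ x → ℤ.≤-trans (ℤ.≤-reflexive (≡.sym (f≗g x))) (IsMaximum.isUpper p x)
  }

difference-mono : ∀ {a b c d} → a ℕ.≤ b → d ℕ.≤ c → + a - + c ≤ + b - + d
difference-mono a≤b d≤c = ℤ.+-mono-≤ (+≤+ a≤b) (ℤ.neg-mono-≤ (+≤+ d≤c))

-- For excesses, `a`, `b`, `c` are edge dimensions and `d`, `e`, `f` vertex dimensions; for Euler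
-- characteristics the two kinds trade places.
difference-subadditive : ∀ a b c d e f → c ℕ.≤ a ℕ.+ b → d ℕ.+ e ℕ.≤ f →
                         + c - + f ≤ (+ a - + d) + (+ b - + e)
difference-subadditive a b c d e f c≤ ≤f = ℤ.≤-trans (difference-mono c≤ ≤f)
  (ℤ.≤-reflexive (regroup (+ a) (+ b) (+ d) (+ e)))

difference-superadditive : ∀ a b c d e f → a ℕ.+ b ℕ.≤ c → f ℕ.≤ d ℕ.+ e →
                           (+ a - + d) + (+ b - + e) ≤ + c - + f
difference-superadditive a b c d e f ≤c f≤ = ℤ.≤-trans
  (ℤ.≤-reflexive (≡.sym (regroup (+ a) (+ b) (+ d) (+ e)))) (difference-mono ≤c f≤)

cancel : ∀ v e x → x ≡ (v - e) + ((e - v) + x)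
cancel = solve 3 (λ v e x → x := (v :- e) :+ ((e :- v) :+ x)) refl

nonneg : ∀ v e k → e - v ≤ k → 0ℤ ≤ (v - e) + k
nonneg v e k e-v≤k = ℤ.≤-trans
  (ℤ.≤-reflexive (solve 2 (λ v e → con 0ℤ := (v :- e) :+ (e :- v)) refl v e))
  (ℤ.+-monoʳ-≤ (v - e) e-v≤k)

-- The `a` are maximum excesses and the `x` Euler characteristics. Each of `mono`, `subadditive` and
-- `quotient` serves twice, once for an α₁ term and once, after adding Euler characteristics, for an
-- α₀ term. The two inequalities around the passage from α₁ to α₀ also use a non-negative term as
-- slack.
triangular : ∀ a₁ a₂ a₃ x₁ x₂ x₃ → x₂ ≡ x₁ + x₃ → 0ℤ ≤ a₁ → 0ℤ ≤ x₃ + a₃ →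
             a₁ ≤ a₂ → a₂ ≤ a₁ + a₃ → a₃ ≤ x₁ + a₂ →
             Triangular (0ℤ ∷ a₁ ∷ a₂ ∷ a₃ ∷ x₁ + a₁ ∷ x₂ + a₂ ∷ x₃ + a₃ ∷ 0ℤ ∷ [])
triangular a₁ a₂ a₃ x₁ _ x₃ refl 0≤a₁ 0≤x₃+a₃ mono subadditive quotient =
  (begin
    a₁                            ≤⟨ mono ⟩
    a₂                            ≡⟨ ℤ.+-identityˡ a₂ ⟨
    0ℤ + a₂                       ∎)
  , subadditive
  , (begin
    a₃                            ≤⟨ quotient ⟩
    x₁ + a₂                       ≡⟨ ℤ.+-identityʳ _ ⟨
    (x₁ + a₂) + 0ℤ                ≤⟨ ℤ.+-monoʳ-≤ (x₁ + a₂) 0≤a₁ ⟩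
    (x₁ + a₂) + a₁                ≡⟨ solve 3 (λ x₁ a₂ a₁ → (x₁ :+ a₂) :+ a₁
                                       := a₂ :+ (x₁ :+ a₁)) refl x₁ a₂ a₁ ⟩
    a₂ + (x₁ + a₁)                ∎)
  , (begin
    x₁ + a₁                       ≤⟨ ℤ.+-monoʳ-≤ x₁ mono ⟩
    x₁ + a₂                       ≡⟨ ℤ.+-identityʳ _ ⟨
    (x₁ + a₂) + 0ℤ                ≤⟨ ℤ.+-monoʳ-≤ (x₁ + a₂) 0≤x₃+a₃ ⟩
    (x₁ + a₂) + (x₃ + a₃)         ≡⟨ solve 4 (λ x₁ a₂ x₃ a₃ → (x₁ :+ a₂) :+ (x₃ :+ a₃)
                                       := a₃ :+ ((x₁ :+ x₃) :+ a₂)) refl x₁ a₂ x₃ a₃ ⟩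
    a₃ + ((x₁ + x₃) + a₂)         ∎)
  , (begin
    (x₁ + x₃) + a₂                ≤⟨ ℤ.+-monoʳ-≤ (x₁ + x₃) subadditive ⟩
    (x₁ + x₃) + (a₁ + a₃)         ≡⟨ ℤ-interchange x₁ x₃ a₁ a₃ ⟩
    (x₁ + a₁) + (x₃ + a₃)         ∎)
  , (begin
    x₃ + a₃                       ≤⟨ ℤ.+-monoʳ-≤ x₃ quotient ⟩
    x₃ + (x₁ + a₂)                ≡⟨ solve 3 (λ x₃ x₁ a₂ → x₃ :+ (x₁ :+ a₂)
                                       := ((x₁ :+ x₃) :+ a₂) :+ con 0ℤ) refl x₃ x₁ a₂ ⟩
    ((x₁ + x₃) + a₂) + 0ℤ         ∎)
  , tt
  where
  open ℤ.≤-Reasoning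

-- Morphisms of sheaves and their effect on Γʰᵗ.

module SheafProperties {ℓ : Level} (𝔽 : HeytingField ℓ ℓ ℓ) (G : Digraph) where

  open LinearAlgebra 𝔽
  open LinearAlgebraProperties 𝔽
  open Sheaves 𝔽 G
  open Digraph G
  open Sheaves.Sheaf

  module _ {F F′ : Sheaf} (φ : Morphism F F′) where
    private
      module φ = Morphism φ
      module V′ = LeftModule (onV F′)

    mapV : LinearMap (onV F) (onV F′)
    mapV = ⨁-map (φ.map ∘ inj₁)

    module _ (end : Edge → Vertex)
             (r  : ∀ e → LinearMap (value F  (inj₂ e)) (value F  (inj₁ (end e))))
             (r′ : ∀ e → LinearMap (value F′ (inj₂ e)) (value F′ (inj₁ (end e)))) where
      private
        p : ∀ e → LinearMap (value F (inj₂ e)) (onV F)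
        p e = ι (value F ∘ inj₁) (end e) ∘ˡ r e

        q : ∀ e → LinearMap (value F′ (inj₂ e)) (onV F′)
        q e = ι (value F′ ∘ inj₁) (end e) ∘ˡ r′ e

      -- With `end` left arbitrary, one argument covers heads and tails: both the inclusions of
      -- summands and the copairing are natural.
      d-natural : (∀ e x → LeftModule._≈ᴹ_ (value F′ (inj₁ (end e)))
                     (⟦ r′ e ⟧ (⟦ φ.map (inj₂ e) ⟧ x)) (⟦ φ.map (inj₁ (end e)) ⟧ (⟦ r e ⟧ x))) →
        ∀ e w → ⟦ mapV ⟧ (⟦ copair (onV F) p ⟧ (⟦ ι (value F ∘ inj₂) e ⟧ w)) V′.≈ᴹ
                ⟦ copair (onV F′) q ⟧ (⟦ ι (value F′ ∘ inj₂) e ⟧ (⟦ φ.map (inj₂ e) ⟧ w))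
      d-natural commutes e w = V′.≈ᴹ-trans
        (copair-natural (φ.map ∘ inj₂) mapV p q
          (λ e x → V′.≈ᴹ-trans (ι-natural (φ.map ∘ inj₁) (end e) (⟦ r e ⟧ x))
            (LinearMap.⟦⟧-cong (ι (value F′ ∘ inj₁) (end e))
              (LeftModule.≈ᴹ-sym (value F′ (inj₁ (end e))) (commutes e x))))
          (⟦ ι (value F ∘ inj₂) e ⟧ w))
        (LinearMap.⟦⟧-cong (copair (onV F′) q) (ι-natural (φ.map ∘ inj₂) e w))

    dʰ-natural = d-natural head (restrictʰ F) (restrictʰ F′) φ.commutesʰ
    dᵗ-natural = d-natural tail (restrictᵗ F) (restrictᵗ F′) φ.commutesᵗ

    module _ (U : Subspace (onV F)) (U′ : Subspace (onV F′)) where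
      private
        module U  = Subspace U
        module U′ = Subspace U′
        module Γ  (e : Edge) = Subspace (Γʰᵗ-at F U e)
        module Γ′ (e : Edge) = Subspace (Γʰᵗ-at F′ U′ e)

      Γʰᵗ-map : (∀ {x} → x U.∈ → ⟦ mapV ⟧ x U′.∈) →
                ∀ e {w} → Γ._∈ e w → Γ′._∈ e (⟦ φ.map (inj₂ e) ⟧ w)
      Γʰᵗ-map U⇒U′ e {w} (h , t) = U′.∈-resp-≈ᴹ (dʰ-natural e w) (U⇒U′ h)
                                 , U′.∈-resp-≈ᴹ (dᵗ-natural e w) (U⇒U′ t)

      -- Applied with `U` the preimage of `U′`, where the hypothesis is `id`: an edge vector then
      -- lies in Γʰᵗ as soon as its image does.
      Γʰᵗ-reflect : (∀ {x} → ⟦ mapV ⟧ x U′.∈ → x U.∈) →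
                    ∀ e {w} → Γ′._∈ e (⟦ φ.map (inj₂ e) ⟧ w) → Γ._∈ e w
      Γʰᵗ-reflect U′⇒U e {w} (h , t) = U′⇒U (U′.∈-resp-≈ᴹ (V′.≈ᴹ-sym (dʰ-natural e w)) h)
                                     , U′⇒U (U′.∈-resp-≈ᴹ (V′.≈ᴹ-sym (dᵗ-natural e w)) t)

  -- Direct sums as split short exact sequences.

  module DirectSum (F₁ F₂ : Sheaf) where
    private
      module F₁ (P : Point) = LeftModule (value F₁ P)
      module F₂ (P : Point) = LeftModule (value F₂ P)

    inj₁ᵛ : ∀ P → LinearMap (value F₁ P) (value F₁ P ×ᵛ value F₂ P)
    inj₁ᵛ P = linearMap (λ x → x , F₂.0ᴹ P) (λ p → p , F₂.≈ᴹ-refl P)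
      (λ _ _ → F₁.≈ᴹ-refl P , F₂.≈ᴹ-sym P (F₂.+ᴹ-identityˡ P _))
      (λ a _ → F₁.≈ᴹ-refl P , F₂.≈ᴹ-sym P (F₂.*ₗ-zeroʳ P a))

    proj₁ᵛ : ∀ P → LinearMap (value F₁ P ×ᵛ value F₂ P) (value F₁ P)
    proj₁ᵛ P = linearMap proj₁ proj₁ (λ _ _ → F₁.≈ᴹ-refl P) (λ _ _ → F₁.≈ᴹ-refl P)

    proj₂ᵛ : ∀ P → LinearMap (value F₁ P ×ᵛ value F₂ P) (value F₂ P)
    proj₂ᵛ P = linearMap proj₂ proj₂ (λ _ _ → F₂.≈ᴹ-refl P) (λ _ _ → F₂.≈ᴹ-refl P)

    ⊕-inj₁ : Morphism F₁ (F₁ ⊕ F₂)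
    ⊕-inj₁ = record
      { map       = inj₁ᵛ
      ; commutesᵗ = λ e x → F₁.≈ᴹ-refl _ , LinearMap.0ᴹ-homo (restrictᵗ F₂ e)
      ; commutesʰ = λ e x → F₁.≈ᴹ-refl _ , LinearMap.0ᴹ-homo (restrictʰ F₂ e)
      }

    ⊕-proj₁ : Morphism (F₁ ⊕ F₂) F₁
    ⊕-proj₁ = record
      { map       = proj₁ᵛ
      ; commutesᵗ = λ e x → F₁.≈ᴹ-refl _
      ; commutesʰ = λ e x → F₁.≈ᴹ-refl _
      }

    ⊕-proj₂ : Morphism (F₁ ⊕ F₂) F₂
    ⊕-proj₂ = record
      { map       = proj₂ᵛ
      ; commutesᵗ = λ e x → F₂.≈ᴹ-refl _
      ; commutesʰ = λ e x → F₂.≈ᴹ-refl _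
      }

    ⊕-shortExact : ShortExact F₁ (F₁ ⊕ F₂) F₂
    ⊕-shortExact = record
      { α          = ⊕-inj₁
      ; β          = ⊕-proj₂
      ; injective  = λ P → proj₁
      ; exact      = λ P (x , y) → mk⇔ (λ y≈0 → x , F₁.≈ᴹ-refl P , F₂.≈ᴹ-sym P y≈0)
                                       (λ (_ , _ , 0≈y) → F₂.≈ᴹ-sym P 0≈y)
      ; surjective = λ P y → (F₁.0ᴹ P , y) , proj₂
      }

  -- Excess along a short exact sequence.

  module _ {F₁ F₂ F₃ : Sheaf} (ses : ShortExact F₁ F₂ F₃) where
    private
      open ShortExact ses
      module α = Morphism α
      module β = Morphism β
      module F₁ (P : Point) = LeftModule (value F₁ P)
      module F₂ (P : Point) = LeftModule (value F₂ P)
      module F₃ (P : Point) = LeftModule (value F₃ P)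
      module V₃ = LeftModule (onV F₃)
      αV = mapV α
      βV = mapV β

      α-ker≈0 : ∀ P x → F₂._≈ᴹ_ P (⟦ α.map P ⟧ x) (F₂.0ᴹ P) → F₁._≈ᴹ_ P x (F₁.0ᴹ P)
      α-ker≈0 P x αx≈0 = injective P (F₂.≈ᴹ-trans P αx≈0
        (F₂.≈ᴹ-sym P (LinearMap.0ᴹ-homo (α.map P))))

      βα≈0 : ∀ P x → F₃._≈ᴹ_ P (⟦ β.map P ⟧ (⟦ α.map P ⟧ x)) (F₃.0ᴹ P)
      βα≈0 P x = Equivalence.from (exact P _) (x , F₂.≈ᴹ-refl P)

      β-ker⊆im : ∀ P y → F₃._≈ᴹ_ P (⟦ β.map P ⟧ y) (F₃.0ᴹ P) →
                 ∃[ x ] F₂._≈ᴹ_ P (⟦ α.map P ⟧ x) y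
      β-ker⊆im P y = Equivalence.to (exact P y)

      β-lift : ∀ P z → ∃[ y ] F₃._≈ᴹ_ P (⟦ β.map P ⟧ y) z
      β-lift P z = let y , βy≈z = surjective P z in y , βy≈z (F₂.≈ᴹ-refl P)

      βV-ker⊆im : ∀ y → ⟦ βV ⟧ y V₃.≈ᴹ V₃.0ᴹ → ∃[ x ] LeftModule._≈ᴹ_ (onV F₂) (⟦ αV ⟧ x) y
      βV-ker⊆im y p = (λ v → proj₁ (β-ker⊆im (inj₁ v) (y v) (p v)))
                    , (λ v → proj₂ (β-ker⊆im (inj₁ v) (y v) (p v)))

    -- A splitting expressed on values. A lift of `z` killed by `ρ` allows membership conditions
    -- imposed through `ρ` and through `β` to be met independently.
    record IsRetraction (ρ : Morphism F₂ F₁) : Set ℓ where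
      private
        module ρ = Morphism ρ
      field
        ρα≈id : ∀ P x → F₁._≈ᴹ_ P (⟦ ρ.map P ⟧ (⟦ α.map P ⟧ x)) x
        lift  : ∀ P z → ∃[ y ] F₃._≈ᴹ_ P (⟦ β.map P ⟧ y) z × F₁._≈ᴹ_ P (⟦ ρ.map P ⟧ y) (F₁.0ᴹ P)

    module _ (em : ExcludedMiddle ℓ) where
      private
        Γ-fd : (F : Sheaf) (U : Subspace (onV F)) (e : Edge) →
               FiniteDimensional (toSpace (Γʰᵗ-at F U e))
        Γ-fd F U e = subspace-fd em (finiteDimensional F (inj₂ e)) (Γʰᵗ-at F U e)

      χ-additive : χ F₂ ≡ χ F₁ + χ F₃
      χ-additive = ℤ.≤-antisym
        (difference-subadditive (dimV F₁) (dimV F₃) (dimV F₂) (dimE F₁) (dimE F₃) (dimE F₂) V≤ ≤E)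
        (difference-superadditive (dimV F₁) (dimV F₃) (dimV F₂) (dimE F₁) (dimE F₃) (dimE F₂) ≤V E≤)
        where
        dimV dimE : Sheaf → ℕ
        dimV F = dim (onV-fd F)
        dimE F = dim (onE-fd F)

        module _ {n} (P : Fin n → Point) where
          F-fd : (F : Sheaf) (i : Fin n) → FiniteDimensional (value F (P i))
          F-fd F i = finiteDimensional F (P i)

          ⨁-subadditive : dim (⨁-fd (F-fd F₂)) ℕ.≤ dim (⨁-fd (F-fd F₁)) ℕ.+ dim (⨁-fd (F-fd F₃))
          ⨁-subadditive = dim-⨁-subadditive (F-fd F₁) (F-fd F₂) (F-fd F₃) λ i →
            dim-subadditive em (F-fd F₁ i) (F-fd F₂ i) (F-fd F₃ i)
              (α.map (P i)) (β.map (P i)) (β-ker⊆im (P i))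

          ⨁-superadditive : dim (⨁-fd (F-fd F₁)) ℕ.+ dim (⨁-fd (F-fd F₃)) ℕ.≤ dim (⨁-fd (F-fd F₂))
          ⨁-superadditive = dim-⨁-superadditive (F-fd F₁) (F-fd F₂) (F-fd F₃) λ i →
            dim-superadditive em (F-fd F₁ i) (F-fd F₂ i) (F-fd F₃ i)
              (α.map (P i)) (β.map (P i)) (α-ker≈0 (P i)) (βα≈0 (P i)) (β-lift (P i))

        V≤ = ⨁-subadditive inj₁
        E≤ = ⨁-subadditive inj₂
        ≤V = ⨁-superadditive inj₁
        ≤E = ⨁-superadditive inj₂

      -- Passing to the image under `α` cannot raise the subtracted dimension, and `α` embeds the
      -- old edge part in the new one.
      excess-pushforward : (U : Subspace (onV F₁)) →
        Σ[ U′ ∈ Subspace (onV F₂) ] excess F₁ em U ≤ excess F₂ em U′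
      excess-pushforward U = U′ , difference-mono
        (dim-⨁-mono (Γ-fd F₁ U) (Γ-fd F₂ U′) λ e →
          injective⇒dim≤ em (Γ-fd F₁ U e) (Γ-fd F₂ U′ e)
            (restrict (α.map (inj₂ e)) (Γʰᵗ-at F₁ U e) (Γʰᵗ-at F₂ U′ e)
              (Γʰᵗ-map α U U′ U⇒U′ e))
            λ (w , _) → α-ker≈0 (inj₂ e) w)
        (surjective⇒dim≤ em (subspace-fd em (onV-fd F₁) U) (subspace-fd em (onV-fd F₂) U′)
          (restrict αV U U′ U⇒U′) λ (_ , x , αx≈y) → x , αx≈y)
        where
        U′ = image (αV ∘ˡ inclusion U)

        U⇒U′ : ∀ {x} → Subspace._∈ U x → Subspace._∈ U′ (⟦ αV ⟧ x)
        U⇒U′ {x} x∈ = (x , x∈) , LeftModule.≈ᴹ-refl (onV F₂)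

      -- Only an inequality: an edge vector in the Γʰᵗ of `U₃` has lifts whose ends are in `U`
      -- merely up to the image of F₁(V), so the edge part of `U` need not map onto it.
      excess-subadditive : (U : Subspace (onV F₂)) →
        Σ[ U₁ ∈ Subspace (onV F₁) ] Σ[ U₃ ∈ Subspace (onV F₃) ]
        excess F₂ em U ≤ excess F₁ em U₁ + excess F₃ em U₃
      excess-subadditive U = U₁ , U₃ , difference-subadditive _ _ _ (dim U₁-fd) (dim U₃-fd) (dim U-fd)
        (dim-⨁-subadditive (Γ-fd F₁ U₁) (Γ-fd F₂ U) (Γ-fd F₃ U₃) λ e →
          dim-subadditive em (Γ-fd F₁ U₁ e) (Γ-fd F₂ U e) (Γ-fd F₃ U₃ e)
            (restrict (α.map (inj₂ e)) (Γʰᵗ-at F₁ U₁ e) (Γʰᵗ-at F₂ U e) (Γʰᵗ-map α U₁ U id e))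
            (restrict (β.map (inj₂ e)) (Γʰᵗ-at F₂ U e) (Γʰᵗ-at F₃ U₃ e) (Γʰᵗ-map β U U₃ U⇒U₃ e))
            λ (w , w∈) βw≈0 →
              let x , αx≈w = β-ker⊆im (inj₂ e) w βw≈0
              in (x , Γʰᵗ-reflect α U₁ U id e
                        (Subspace.∈-resp-≈ᴹ (Γʰᵗ-at F₂ U e) (F₂.≈ᴹ-sym (inj₂ e) αx≈w) w∈)) , αx≈w)
        (dim-superadditive em U₁-fd U-fd U₃-fd
          (restrict αV U₁ U id) (restrict βV U U₃ U⇒U₃)
          (λ (x , _) αx≈0 v → α-ker≈0 (inj₁ v) (x v) (αx≈0 v))
          (λ (x , _) v → βα≈0 (inj₁ v) (x v))
          (λ (_ , y , βy≈z) → y , βy≈z))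
        where
        U₁    = preimage αV U
        U₃    = image (βV ∘ˡ inclusion U)
        U₁-fd = subspace-fd em (onV-fd F₁) U₁
        U-fd  = subspace-fd em (onV-fd F₂) U
        U₃-fd = subspace-fd em (onV-fd F₃) U₃

        U⇒U₃ : ∀ {x} → Subspace._∈ U x → Subspace._∈ U₃ (⟦ βV ⟧ x)
        U⇒U₃ {x} x∈ = (x , x∈) , V₃.≈ᴹ-refl

      -- Since `β` kills the image of `α`, the preimage contains all of F₁(V) and its Γʰᵗ contains
      -- all of F₁(E). This full copy of F₁ accounts for the term `χ F₁`.
      excess-pullback : (U : Subspace (onV F₃)) →
        Σ[ U′ ∈ Subspace (onV F₂) ] excess F₃ em U ≤ χ F₁ + excess F₂ em U′
      excess-pullback U = U′ , (begin
        excess F₃ em U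
          ≡⟨ cancel (+ dim (onV-fd F₁)) (+ dim (onE-fd F₁)) (excess F₃ em U) ⟩
        χ F₁ + ((+ dim (onE-fd F₁) - + dim (onV-fd F₁)) + excess F₃ em U)
          ≤⟨ ℤ.+-monoʳ-≤ (χ F₁)
            (difference-superadditive _ _ _ (dim (onV-fd F₁)) (dim U-fd) (dim U′-fd) Γ-≤ U-≤) ⟩
        χ F₁ + excess F₂ em U′ ∎)
        where
        open ℤ.≤-Reasoning
        module U = Subspace U
        module Γ (e : Edge) = Subspace (Γʰᵗ-at F₃ U e)

        U′    = preimage βV U
        U-fd  = subspace-fd em (onV-fd F₃) U
        U′-fd = subspace-fd em (onV-fd F₂) U′

        Γ-≤ : dim (onE-fd F₁) ℕ.+ dim (Γʰᵗ-fd F₃ em U) ℕ.≤ dim (Γʰᵗ-fd F₂ em U′)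
        Γ-≤ = dim-⨁-superadditive (finiteDimensional F₁ ∘ inj₂) (Γ-fd F₂ U′) (Γ-fd F₃ U) λ e →
          dim-superadditive em (finiteDimensional F₁ (inj₂ e)) (Γ-fd F₂ U′ e) (Γ-fd F₃ U e)
            (corestrict (α.map (inj₂ e)) (Γʰᵗ-at F₂ U′ e) λ x → Γʰᵗ-reflect β U′ U id e
              (Γ.∈-resp-≈ᴹ e (F₃.≈ᴹ-sym (inj₂ e) (βα≈0 (inj₂ e) x)) (Γ.0ᴹ-∈ e)))
            (restrict (β.map (inj₂ e)) (Γʰᵗ-at F₂ U′ e) (Γʰᵗ-at F₃ U e) (Γʰᵗ-map β U′ U id e))
            (α-ker≈0 (inj₂ e))
            (βα≈0 (inj₂ e))
            λ (z , z∈) → let y , βy≈z = β-lift (inj₂ e) z in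
              (y , Γʰᵗ-reflect β U′ U id e (Γ.∈-resp-≈ᴹ e (F₃.≈ᴹ-sym (inj₂ e) βy≈z) z∈)) , βy≈z

        U-≤ : dim U′-fd ℕ.≤ dim (onV-fd F₁) ℕ.+ dim U-fd
        U-≤ = dim-subadditive em (onV-fd F₁) U′-fd U-fd
          (corestrict αV U′ λ x → U.∈-resp-≈ᴹ
            (V₃.≈ᴹ-sym {⟦ βV ⟧ (⟦ αV ⟧ x)} λ v → βα≈0 (inj₁ v) (x v)) U.0ᴹ-∈)
          (restrict βV U′ U id)
          λ (y , _) → βV-ker⊆im y

      module _ (ρ : Morphism F₂ F₁) where
        private
          module ρ = Morphism ρ
          ρV = mapV ρ

        module _ (retraction : IsRetraction ρ) where
          open IsRetraction retraction

          -- The witness cut out by `ρ` and `β` plays the part of the direct sum of `U₁` and `U₃`.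
          excess-split : (U₁ : Subspace (onV F₁)) (U₃ : Subspace (onV F₃)) →
            Σ[ U ∈ Subspace (onV F₂) ] excess F₁ em U₁ + excess F₃ em U₃ ≤ excess F₂ em U
          excess-split U₁ U₃ =
            U , difference-superadditive _ _ _ (dim U₁-fd) (dim U₃-fd) (dim U-fd) Γ-≤ U-≤
            where
            module V₁ = LeftModule (onV F₁)
            module U₁ = Subspace U₁
            module U₃ = Subspace U₃
            module Γ₁ (e : Edge) = Subspace (Γʰᵗ-at F₁ U₁ e)
            module Γ₃ (e : Edge) = Subspace (Γʰᵗ-at F₃ U₃ e)

            U     = preimage ρV U₁ ∩ preimage βV U₃
            U₁-fd = subspace-fd em (onV-fd F₁) U₁
            U₃-fd = subspace-fd em (onV-fd F₃) U₃
            U-fd  = subspace-fd em (onV-fd F₂) U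

            ∈Γ : ∀ e {w} → Γ₁._∈ e (⟦ ρ.map (inj₂ e) ⟧ w) → Γ₃._∈ e (⟦ β.map (inj₂ e) ⟧ w) →
                 Subspace._∈ (Γʰᵗ-at F₂ U e) w
            ∈Γ e ρw∈ βw∈ =
              let h₁ , t₁ = Γʰᵗ-reflect ρ (preimage ρV U₁) U₁ id e ρw∈
                  h₃ , t₃ = Γʰᵗ-reflect β (preimage βV U₃) U₃ id e βw∈
              in (h₁ , h₃) , (t₁ , t₃)

            αV-∈ : ∀ {x} → x U₁.∈ → Subspace._∈ U (⟦ αV ⟧ x)
            αV-∈ {x} x∈ =
                U₁.∈-resp-≈ᴹ
                  (V₁.≈ᴹ-sym {⟦ ρV ⟧ (⟦ αV ⟧ x)} {x} λ v → ρα≈id (inj₁ v) (x v)) x∈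
              , U₃.∈-resp-≈ᴹ
                  (V₃.≈ᴹ-sym {⟦ βV ⟧ (⟦ αV ⟧ x)} λ v → βα≈0 (inj₁ v) (x v)) U₃.0ᴹ-∈

            Γ-≤ : dim (Γʰᵗ-fd F₁ em U₁) ℕ.+ dim (Γʰᵗ-fd F₃ em U₃) ℕ.≤ dim (Γʰᵗ-fd F₂ em U)
            Γ-≤ = dim-⨁-superadditive (Γ-fd F₁ U₁) (Γ-fd F₂ U) (Γ-fd F₃ U₃) λ e →
              dim-superadditive em (Γ-fd F₁ U₁ e) (Γ-fd F₂ U e) (Γ-fd F₃ U₃ e)
                (restrict (α.map (inj₂ e)) (Γʰᵗ-at F₁ U₁ e) (Γʰᵗ-at F₂ U e) (Γʰᵗ-map α U₁ U αV-∈ e))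
                (restrict (β.map (inj₂ e)) (Γʰᵗ-at F₂ U e) (Γʰᵗ-at F₃ U₃ e) (Γʰᵗ-map β U U₃ proj₂ e))
                (λ (w , _) → α-ker≈0 (inj₂ e) w)
                (λ (w , _) → βα≈0 (inj₂ e) w)
                -- An arbitrary lift might violate the condition coming from `U₁`; one killed by `ρ`
                -- meets it trivially.
                λ (z , z∈) → let y , βy≈z , ρy≈0 = lift (inj₂ e) z in
                  (y , ∈Γ e (Γ₁.∈-resp-≈ᴹ e (F₁.≈ᴹ-sym (inj₂ e) ρy≈0) (Γ₁.0ᴹ-∈ e))
                            (Γ₃.∈-resp-≈ᴹ e (F₃.≈ᴹ-sym (inj₂ e) βy≈z) z∈)) , βy≈z

            U-≤ : dim U-fd ℕ.≤ dim U₁-fd ℕ.+ dim U₃-fd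
            U-≤ = dim-subadditive em U₁-fd U-fd U₃-fd
              (restrict αV U₁ U αV-∈) (restrict βV U U₃ proj₂)
              -- Exactness writes `y` as the image of some `x`, and applying `ρ` recovers `x`, which
              -- therefore lies in `U₁`.
              λ (y , ρy∈ , _) βy≈0 → let x , αx≈y = βV-ker⊆im y βy≈0 in
                (x , U₁.∈-resp-≈ᴹ
                  (V₁.≈ᴹ-trans {⟦ ρV ⟧ y} {⟦ ρV ⟧ (⟦ αV ⟧ x)} {x}
                    (λ v → LinearMap.⟦⟧-cong (ρ.map (inj₁ v)) (F₂.≈ᴹ-sym (inj₁ v) (αx≈y v)))
                    (λ v → ρα≈id (inj₁ v) (x v))) ρy∈) , αx≈y

  ⊕-retraction : (F₁ F₂ : Sheaf) → (let open DirectSum F₁ F₂) → IsRetraction ⊕-shortExact ⊕-proj₁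
  ⊕-retraction F₁ F₂ = record
    { ρα≈id = λ P _ → LeftModule.≈ᴹ-refl (value F₁ P)
    ; lift  = λ P z → (LeftModule.0ᴹ (value F₁ P) , z)
                    , LeftModule.≈ᴹ-refl (value F₂ P) , LeftModule.≈ᴹ-refl (value F₁ P)
    }

  -- The two extreme subspaces and the quasi-Betti properties.

  module _ (em : ExcludedMiddle ℓ) where

    excess-zero-nonneg : (F : Sheaf) → 0ℤ ≤ excess F em (zeroSubspace (onV F))
    excess-zero-nonneg F = ℤ.i≤j⇒0≤j-i (+≤+ (ℕ.≤-trans
      (ℕ.≤-reflexive (dim-zeroSubspace em (onV-fd F))) z≤n))

    -χ≤excess-full : (F : Sheaf) →
      + dim (onE-fd F) - + dim (onV-fd F) ≤ excess F em (fullSubspace (onV F))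
    -χ≤excess-full F = difference-mono
      (dim-⨁-mono (finiteDimensional F ∘ inj₂) _ λ e →
        injective⇒dim≤ em (finiteDimensional F (inj₂ e))
          (subspace-fd em (finiteDimensional F (inj₂ e)) (Γʰᵗ-at F V e))
          (corestrict (identity (value F (inj₂ e))) (Γʰᵗ-at F V e)
            λ w → (_ , V.≈ᴹ-refl) , (_ , V.≈ᴹ-refl))
          λ _ → id)
      (dim-subspace-≤ em (onV-fd F) V)
      where
      V = fullSubspace (onV F)
      module V = LeftModule (onV F)

  -- The maximum excess enters only through its defining property, which keeps the search that
  -- computes it out of the arguments.
  module QuasiBetti (em : ExcludedMiddle ℓ) (α₁ : Sheaf → ℤ)
                    (isMaximum : (F : Sheaf) → IsMaximum (excess F em) (α₁ F)) where

    open ℤ.≤-Reasoning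
    private
      module Max (F : Sheaf) = IsMaximum (isMaximum F)

    α₀ : Sheaf → ℤ
    α₀ F = χ F + α₁ F

    α₁≤ : (F : Sheaf) {k : ℤ} → ((U : Subspace (onV F)) → excess F em U ≤ k) → α₁ F ≤ k
    α₁≤ F {k} bound = let U , eq = Max.attained F in ≡.subst (λ i → i ≤ k) eq (bound U)

    α₁-nonneg : (F : Sheaf) → 0ℤ ≤ α₁ F
    α₁-nonneg F = ℤ.≤-trans (excess-zero-nonneg em F) (Max.isUpper F (zeroSubspace (onV F)))

    α₀-nonneg : (F : Sheaf) → 0ℤ ≤ α₀ F
    α₀-nonneg F = nonneg (+ dim (onV-fd F)) (+ dim (onE-fd F)) (α₁ F)
      (ℤ.≤-trans (-χ≤excess-full em F) (Max.isUpper F (fullSubspace (onV F))))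

    module _ {F₁ F₂ F₃ : Sheaf} (ses : ShortExact F₁ F₂ F₃) where

      α₁-mono : α₁ F₁ ≤ α₁ F₂
      α₁-mono = α₁≤ F₁ λ U → let U′ , le = excess-pushforward ses em U in
        ℤ.≤-trans le (Max.isUpper F₂ U′)

      α₁-subadditive : α₁ F₂ ≤ α₁ F₁ + α₁ F₃
      α₁-subadditive = α₁≤ F₂ λ U → let U₁ , U₃ , le = excess-subadditive ses em U in
        ℤ.≤-trans le (ℤ.+-mono-≤ (Max.isUpper F₁ U₁) (Max.isUpper F₃ U₃))

      α₁-quotient : α₁ F₃ ≤ χ F₁ + α₁ F₂
      α₁-quotient = α₁≤ F₃ λ U → let U′ , le = excess-pullback ses em U in
        ℤ.≤-trans le (ℤ.+-monoʳ-≤ (χ F₁) (Max.isUpper F₂ U′))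

      α-triangular : Triangular (0ℤ ∷ α₁ F₁ ∷ α₁ F₂ ∷ α₁ F₃ ∷ α₀ F₁ ∷ α₀ F₂ ∷ α₀ F₃ ∷ 0ℤ ∷ [])
      α-triangular = triangular (α₁ F₁) (α₁ F₂) (α₁ F₃) (χ F₁) (χ F₂) (χ F₃) (χ-additive ses em)
        (α₁-nonneg F₁) (α₀-nonneg F₃) α₁-mono α₁-subadditive α₁-quotient

      -- The two values at F₂ are described by dimensions over unspecified bases: at F₂ = F₁ ⊕ F₃,
      -- type checking an equation with α₁ F₂ itself would unfold all the bases it is built from.
      module _ {ρ : Morphism F₂ F₁} (retraction : IsRetraction ses ρ)
               {V : Subspace (onV F₂) → Edge → VectorSpace}
               (V-fd : ∀ U e → FiniteDimensional (V U e))
               {k : ℤ}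
               (k-max : IsMaximum
                 (λ U → + dim (⨁-fd (V-fd U)) - + dim (subspace-fd em (onV-fd F₂) U)) k)
               (dim-V≡ : ∀ U e → dim (V-fd U e) ≡
                 dim (subspace-fd em (finiteDimensional F₂ (inj₂ e)) (Γʰᵗ-at F₂ U e))) where

        k-max′ : IsMaximum (excess F₂ em) k
        k-max′ = isMaximum-cong k-max λ U →
          ≡.cong (λ γ → + γ - + dim (subspace-fd em (onV-fd F₂) U))
            (dim-⨁-cong (V-fd U) _ (dim-V≡ U))

        α₁-split : k ≡ α₁ F₁ + α₁ F₃
        α₁-split = ≡.trans (isMaximum-unique k-max′ (isMaximum F₂)) (ℤ.≤-antisym α₁-subadditive
          -- For the reverse inequality, subspaces attaining the maxima for `F₁` and `F₃` are joined
          -- into one for `F₂`.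
          (let U₁ , eq₁ = Max.attained F₁
               U₃ , eq₃ = Max.attained F₃
               U  , le  = excess-split ses em ρ retraction U₁ U₃
           in begin
             α₁ F₁ + α₁ F₃                       ≡⟨ ≡.cong₂ _+_ eq₁ eq₃ ⟨
             excess F₁ em U₁ + excess F₃ em U₃   ≤⟨ le ⟩
             excess F₂ em U                      ≤⟨ Max.isUpper F₂ U ⟩
             α₁ F₂                               ∎))

        α₀-split : ∀ {x} → x ≡ χ F₂ → x + k ≡ α₀ F₁ + α₀ F₃
        α₀-split x≡χ = ≡.trans (≡.cong₂ _+_ (≡.trans x≡χ (χ-additive ses em)) α₁-split)
          (ℤ-interchange (χ F₁) (χ F₃) (α₁ F₁) (α₁ F₃))

theorem1p5 : ∀ {ℓ : Level} (em : ExcludedMiddle (lsuc ℓ)) (𝔽 : HeytingField ℓ ℓ ℓ) (G : Digraph) →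
    let open Sheaves 𝔽 G
        open MaximumExcess em
    in (∀ F → 0ℤ ≤ α₀ F × 0ℤ ≤ α₁ F)
     × (∀ F₁ F₂ → α₀ (F₁ ⊕ F₂) ≡ α₀ F₁ + α₀ F₂ × α₁ (F₁ ⊕ F₂) ≡ α₁ F₁ + α₁ F₂)
     × (∀ F₁ F₂ F₃ → ShortExact F₁ F₂ F₃ →
          Triangular (0ℤ ∷ α₁ F₁ ∷ α₁ F₂ ∷ α₁ F₃ ∷ α₀ F₁ ∷ α₀ F₂ ∷ α₀ F₃ ∷ 0ℤ ∷ []))
theorem1p5 em 𝔽 G =
    (λ F → α₀-nonneg F , α₁-nonneg F)
  , (λ F₁ F₂ →
        -- Repeating the call of `maximum` made by `maximumExcess` gives a `k` that is the value at
        -- `F₁ ⊕ F₂` itself; the omitted arguments are found by unification.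
        α₀-split (⊕-shortExact F₁ F₂) (⊕-retraction F₁ F₂) _
          (proj₂ (maximum em _ _ (gap (F₁ ⊕ F₂)) _)) (λ U e → refl) refl
      , α₁-split (⊕-shortExact F₁ F₂) (⊕-retraction F₁ F₂) _
          (proj₂ (maximum em _ _ (gap (F₁ ⊕ F₂)) _)) (λ U e → refl))
  , λ F₁ F₂ F₃ ses → α-triangular ses
  where
  open Sheaves 𝔽 G using (_⊕_)
  open Sheaves.Sheaf using (onV; onE-fd; onV-fd)
  open Sheaves.MaximumExcess 𝔽 G em using (emˡ; α₁; maximumExcess)
  open LinearAlgebra 𝔽
  open SheafProperties 𝔽 G
  open DirectSum using (⊕-shortExact)
  open QuasiBetti emˡ α₁ (λ F → proj₂ (maximumExcess F))
    using (α₀-nonneg; α₁-nonneg; α₀-split; α₁-split; α-triangular)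

  -- The bound with which maximumExcess calls maximum.
  gap : Sheaves.Sheaf 𝔽 G → ℕ
  gap F = dim (onE-fd F) ℕ.+ dim (subspace-fd emˡ (onV-fd F) (zeroSubspace (onV F)))
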